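{- Let $n$ be a positive integer with $\ln n\ge 1$, let $A>1$ and $B>0$ be real numbers. Let $0=\beta_0<\beta_1<\cdots<\beta_\ell=\infty$ be a non-adaptive $B$-Chebyshev cooling schedule, i.e., a single fixed sequence which is a $B$-Chebyshev cooling schedule for every partition function $Z$ of degree at most $n$ with $Z(0)=A$ and $Z(\infty)\ge 1$. Then $$\ell \ge \ln(n/e)\left(\frac{\ln(A-1)}{\ln(4B)}-1\right).$$
   Context: A partition function of degree $n$ (with $n\ge 0$ an integer) is a function $Z(\beta)=\sum_{i=0}^n a_i e^{ -i\beta}$, where $a_0,\dots,a_n$ are non-negative reals with $a_0\ge 1$; by convention $Z(\infty)=a_0$. For a constant $B>0$, a $B$-Chebyshev cooling schedule for $Z$ is a sequence $0=\beta_0<\beta_1<\cdots<\beta_\ell=\infty$ such that $$\frac{Z(2\beta_{i+1}-\beta_i)\,Z(\beta_i)}{Z(\beta_{i+1})^2}\le B\qquad\text{for all } i=0,\dots,\ell-1,$$ where $2\beta_{i+1}-\beta_i=\infty$ if $\beta_{i+1}=\infty$. -}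

module Defs where

open import Algebra.Bundles.Raw using (RawMonoid)
import Algebra.Definitions.RawMonoid as RawMonoidDefinitions
open import Data.Fin.Base as Fin using (Fin; zero; suc; toℕ; inject₁)
import Data.Integer.Base as ℤ
import Data.Integer.Properties as ℤ
open import Data.Nat.Base as ℕ using (ℕ; zero; suc)
import Data.Nat.Properties as ℕ
open import Data.Product.Base using (∃-syntax; _×_; _,_; proj₁; proj₂)
open import Data.Rational as ℚ using (ℚ; 0ℚ; 1ℚ; ∣_∣)
import Data.Rational.Properties as ℚ
open import Data.Rational.Solver using (module +-*-Solver)
import Data.Rational.Unnormalised as ℚᵘ
import Data.Rational.Unnormalised.Properties as ℚᵘ
open import Data.Sum.Base using (_⊎_; inj₁; inj₂)
open import Level using (0ℓ)
import Relation.Binary.Construct.Add.Supremum.Equality as SupremumEquality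
import Relation.Binary.Construct.Add.Supremum.Strict as SupremumStrict
open import Relation.Binary.PropositionalEquality
open import Relation.Nullary using (yes; no; contradiction)
open import Relation.Nullary.Construct.Add.Supremum using (_⁺; ⊤⁺; [_])
open +-*-Solver using (solve; _:=_; _:+_; _:*_; _:-_; :-_; con)

module Rational where

  open import Data.Rational using (_+_; _*_; _-_; -_; _≤_; _<_; 1/_; _/_)
  open import Data.Rational.Properties

  recip : ℚ → ℚ
  recip p with p ≟ 0ℚ
  ... | yes _   = 0ℚ
  ... | no  p≢0 = 1/_ p {{ℚ.≢-nonZero p≢0}}

  *-recip : ∀ p → p ≢ 0ℚ → p * recip p ≡ 1ℚ
  *-recip p p≢0 with p ≟ 0ℚ
  ... | yes p≡0 = contradiction p≡0 p≢0
  ... | no  p≢0′ = *-inverseʳ p {{ℚ.≢-nonZero p≢0′}}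

  >⇒≢0 : ∀ {p} → 0ℚ < p → p ≢ 0ℚ
  >⇒≢0 0<p refl = <-irrefl refl 0<p

  *-mono : ∀ {a b c d} → 0ℚ ≤ a → a ≤ b → 0ℚ ≤ c → c ≤ d → a * c ≤ b * d
  *-mono {a} {b} {c} {d} 0≤a a≤b 0≤c c≤d = ≤-trans
    (*-monoˡ-≤-nonNeg a {{ℚ.nonNegative 0≤a}} c≤d)
    (*-monoʳ-≤-nonNeg d {{ℚ.nonNegative (≤-trans 0≤c c≤d)}} a≤b)

  *-nonneg : ∀ {a b} → 0ℚ ≤ a → 0ℚ ≤ b → 0ℚ ≤ a * b
  *-nonneg {a} {b} 0≤a 0≤b =
    subst (_≤ a * b) (*-zeroʳ a) (*-monoˡ-≤-nonNeg a {{ℚ.nonNegative 0≤a}} 0≤b)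

  *-pos : ∀ {a b} → 0ℚ < a → 0ℚ < b → 0ℚ < a * b
  *-pos {a} {b} 0<a 0<b =
    subst (_< a * b) (*-zeroʳ a) (*-monoʳ-<-pos a {{ℚ.positive 0<a}} 0<b)

  +-nonneg : ∀ {a b} → 0ℚ ≤ a → 0ℚ ≤ b → 0ℚ ≤ a + b
  +-nonneg = +-mono-≤

  recip-pos : ∀ {p} → 0ℚ < p → 0ℚ < recip p
  recip-pos {p} 0<p = ≰⇒> λ r≤0 → <-irrefl refl (<-≤-trans
    (subst (0ℚ <_) (sym (*-recip p (>⇒≢0 0<p))) (positive⁻¹ 1ℚ))
    (subst (p * recip p ≤_) (*-zeroʳ p) (*-monoˡ-≤-nonNeg p {{ℚ.nonNegative (<⇒≤ 0<p)}} r≤0)))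

  fromℕ : ℕ → ℚ
  fromℕ n = ℤ.+ n / 1

  unit : ℕ → ℚ
  unit k = ℤ.+ 1 / suc k

  fromℕ-suc : ∀ k → fromℕ (suc k) ≡ 1ℚ + fromℕ k
  fromℕ-suc k = toℚᵘ-injective (begin
    ℚ.toℚᵘ (fromℕ (suc k))          ≈⟨ toℚᵘ-fromℚᵘ (ℚᵘ.mkℚᵘ (ℤ.+ suc k) 0) ⟩
    ℚᵘ.mkℚᵘ (ℤ.+ suc k) 0           ≈⟨ ℚᵘ.*≡* (cong (ℤ._* ℤ.+ 1) (cong (λ z → ℤ.+ 1 ℤ.+ z) (sym (ℤ.*-identityʳ (ℤ.+ k))))) ⟩
    ℚᵘ.1ℚᵘ ℚᵘ.+ ℚᵘ.mkℚᵘ (ℤ.+ k) 0    ≈⟨ ℚᵘ.+-cong {ℚᵘ.1ℚᵘ} ℚᵘ.≃-refl (ℚᵘ.≃-sym (toℚᵘ-fromℚᵘ (ℚᵘ.mkℚᵘ (ℤ.+ k) 0))) ⟩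
    ℚᵘ.1ℚᵘ ℚᵘ.+ ℚ.toℚᵘ (fromℕ k)     ≈⟨ ℚᵘ.≃-sym (toℚᵘ-homo-+ 1ℚ (fromℕ k)) ⟩
    ℚ.toℚᵘ (1ℚ + fromℕ k)           ∎)
    where open ℚᵘ.≃-Reasoning

  fromℕ*unit : ∀ k → fromℕ (suc k) * unit k ≡ 1ℚ
  fromℕ*unit k = toℚᵘ-injective (begin
    ℚ.toℚᵘ (fromℕ (suc k) * unit k)  ≈⟨ toℚᵘ-homo-* (fromℕ (suc k)) (unit k) ⟩
    ℚ.toℚᵘ (fromℕ (suc k)) ℚᵘ.* ℚ.toℚᵘ (unit k)
       ≈⟨ ℚᵘ.*-cong (toℚᵘ-fromℚᵘ (ℚᵘ.mkℚᵘ (ℤ.+ suc k) 0)) (toℚᵘ-fromℚᵘ (ℚᵘ.mkℚᵘ (ℤ.+ 1) k)) ⟩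
    ℚᵘ.mkℚᵘ (ℤ.+ suc k) 0 ℚᵘ.* ℚᵘ.mkℚᵘ (ℤ.+ 1) k ≈⟨ ℚᵘ.*≡* (trans (ℤ.*-identityʳ _) (trans (ℤ.*-identityʳ _) (sym (trans (ℤ.*-identityˡ _) (cong ℤ.+_ (ℕ.*-identityˡ (suc k))))))) ⟩
    ℚᵘ.1ℚᵘ ∎)
    where open ℚᵘ.≃-Reasoning

  0≤unit : ∀ k → 0ℚ ≤ unit k
  0≤unit k = nonNegative⁻¹ (unit k) {{normalize-nonNeg 1 (suc k)}}

  0≤fromℕ : ∀ k → 0ℚ ≤ fromℕ k
  0≤fromℕ k = nonNegative⁻¹ (fromℕ k) {{normalize-nonNeg k 1}}


  arch : ∀ p → ∃[ n ] p ≤ fromℕ n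
  arch p@record{} = ℤ.∣ ℚ.↥ p ∣ , toℚᵘ-cancel-≤ (ℚᵘ.≤-trans (ℚᵘ.*≤* {ℚ.toℚᵘ p} {N} lem) (ℚᵘ.≤-reflexive (ℚᵘ.≃-sym (toℚᵘ-fromℚᵘ N))))
    where
    N = ℚᵘ.mkℚᵘ (ℤ.+ ℤ.∣ ℚ.↥ p ∣) 0
    i≤∣i∣ : ∀ i → i ℤ.≤ ℤ.+ ℤ.∣ i ∣
    i≤∣i∣ (ℤ.+ _)      = ℤ.≤-refl
    i≤∣i∣ (ℤ.-[1+ _ ]) = ℤ.-≤+
    lem : ℚ.↥ p ℤ.* ℤ.+ 1 ℤ.≤ ℤ.+ ℤ.∣ ℚ.↥ p ∣ ℤ.* ℚ.↧ p
    lem = ℤ.≤-trans (ℤ.≤-reflexive (ℤ.*-identityʳ _)) (ℤ.≤-trans (i≤∣i∣ (ℚ.↥ p)) (ℤ.≤-trans (ℤ.≤-reflexive (sym (ℤ.*-identityʳ _))) (ℤ.*-monoˡ-≤-nonNeg (ℤ.+ ℤ.∣ ℚ.↥ p ∣) (ℤ.+≤+ (ℕ.s≤s ℕ.z≤n)))))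

  abstract
    shrink : ∀ {C ε} → 0ℚ ≤ C → 0ℚ < ε → ∃[ δ ] 0ℚ < δ × C * δ ≤ ε
    shrink {C} {ε} 0≤C 0<ε = ε * recip D , 0<δ , (begin
      C * (ε * recip D)  ≤⟨ *-monoʳ-≤-nonNeg (ε * recip D) {{ℚ.nonNegative (<⇒≤ 0<δ)}} C≤D ⟩
      D * (ε * recip D)  ≡⟨ solve 3 (λ d e r → d :* (e :* r) := e :* (d :* r)) refl D ε (recip D) ⟩
      ε * (D * recip D)  ≡⟨ cong (ε *_) (*-recip D (>⇒≢0 0<D)) ⟩
      ε * 1ℚ             ≡⟨ *-identityʳ ε ⟩
      ε                  ∎)
      where
      open ≤-Reasoning
      D : ℚ
      D = C + 1ℚ
      0<D : 0ℚ < D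
      0<D = +-mono-≤-< 0≤C (positive⁻¹ 1ℚ)
      C≤D : C ≤ D
      C≤D = subst (_≤ D) (+-identityʳ C) (+-monoʳ-≤ C (nonNegative⁻¹ 1ℚ))
      0<δ : 0ℚ < ε * recip D
      0<δ = *-pos 0<ε (recip-pos 0<D)

  p≤∣p∣ : ∀ p → p ≤ ∣ p ∣
  p≤∣p∣ p with ≤-total 0ℚ p
  ... | inj₁ 0≤p = ≤-reflexive (sym (0≤p⇒∣p∣≡p 0≤p))
  ... | inj₂ p≤0 = ≤-trans p≤0 (0≤∣p∣ p)

  ∣-∣-sym : ∀ p q → ∣ p - q ∣ ≡ ∣ q - p ∣
  ∣-∣-sym p q = trans (sym (∣-p∣≡∣p∣ (p - q))) (cong ∣_∣ (solve 2 (λ p q → :- (p :- q) := q :- p) refl p q))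

  ∣-∣-tri : ∀ p q r → ∣ p - r ∣ ≤ ∣ p - q ∣ + ∣ q - r ∣
  ∣-∣-tri p q r = subst (λ z → ∣ z ∣ ≤ ∣ p - q ∣ + ∣ q - r ∣)
    (solve 3 (λ p q r → (p :- q) :+ (q :- r) := p :- r) refl p q r) (∣p+q∣≤∣p∣+∣q∣ (p - q) (q - r))

  ∣*-*∣ : ∀ a b c d → ∣ a * b - c * d ∣ ≤ ∣ a ∣ * ∣ b - d ∣ + ∣ d ∣ * ∣ a - c ∣
  ∣*-*∣ a b c d = begin
    ∣ a * b - c * d ∣                       ≡⟨ cong ∣_∣ (solve 4 (λ a b c d → a :* b :- c :* d := a :* (b :- d) :+ d :* (a :- c)) refl a b c d) ⟩
    ∣ a * (b - d) + d * (a - c) ∣            ≤⟨ ∣p+q∣≤∣p∣+∣q∣ (a * (b - d)) (d * (a - c)) ⟩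
    ∣ a * (b - d) ∣ + ∣ d * (a - c) ∣         ≡⟨ cong₂ _+_ (∣p*q∣≡∣p∣*∣q∣ a (b - d)) (∣p*q∣≡∣p∣*∣q∣ d (a - c)) ⟩
    ∣ a ∣ * ∣ b - d ∣ + ∣ d ∣ * ∣ a - c ∣     ∎
    where open ≤-Reasoning

  recip-lip : ∀ {δ a b} → 0ℚ < δ → δ ≤ ∣ a ∣ → δ ≤ ∣ b ∣ →
              ∣ recip a - recip b ∣ ≤ (recip δ * recip δ) * ∣ a - b ∣
  recip-lip {δ} {a} {b} 0<δ δ≤a δ≤b = begin
    ∣ recip a - recip b ∣
      ≡⟨ cong ∣_∣ (begin-equality
         recip a - recip b ≡⟨ cong₂ _-_ (sym (*-identityʳ (recip a))) (sym (*-identityʳ (recip b))) ⟩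
         recip a * 1ℚ - recip b * 1ℚ ≡⟨ cong₂ (λ x y → recip a * x - recip b * y) (sym (*-recip b (nz δ≤b))) (sym (*-recip a (nz δ≤a))) ⟩
         recip a * (b * recip b) - recip b * (a * recip a) ≡⟨ solve 4 (λ a b r s → r :* (b :* s) :- s :* (a :* r) := (r :* s) :* (b :- a)) refl a b (recip a) (recip b) ⟩
         (recip a * recip b) * (b - a) ∎) ⟩
    ∣ (recip a * recip b) * (b - a) ∣   ≡⟨ ∣p*q∣≡∣p∣*∣q∣ (recip a * recip b) (b - a) ⟩
    ∣ recip a * recip b ∣ * ∣ b - a ∣   ≡⟨ cong₂ _*_ (∣p*q∣≡∣p∣*∣q∣ (recip a) (recip b)) (∣-∣-sym b a) ⟩
    (∣ recip a ∣ * ∣ recip b ∣) * ∣ a - b ∣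
      ≤⟨ *-monoʳ-≤-nonNeg (∣ a - b ∣) {{∣-∣-nonNeg (a - b)}} (*-mono (0≤∣p∣ (recip a)) (bnd δ≤a) (0≤∣p∣ (recip b)) (bnd δ≤b)) ⟩
    (recip δ * recip δ) * ∣ a - b ∣     ∎
    where
    open ≤-Reasoning
    nz : ∀ {c} → δ ≤ ∣ c ∣ → c ≢ 0ℚ
    nz δ≤c refl = <-irrefl refl (<-≤-trans 0<δ δ≤c)
    bnd : ∀ {c} → δ ≤ ∣ c ∣ → ∣ recip c ∣ ≤ recip δ
    bnd {c} δ≤c = begin
      ∣ recip c ∣                        ≡⟨ sym (*-identityˡ _) ⟩
      1ℚ * ∣ recip c ∣                   ≡⟨ cong (_* ∣ recip c ∣) (sym (*-recip δ (>⇒≢0 0<δ))) ⟩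
      (δ * recip δ) * ∣ recip c ∣        ≡⟨ *-assoc δ _ _ ⟩
      δ * (recip δ * ∣ recip c ∣)        ≤⟨ *-mono (<⇒≤ 0<δ) δ≤c (*-nonneg (<⇒≤ (recip-pos 0<δ)) (0≤∣p∣ (recip c))) ≤-refl ⟩
      ∣ c ∣ * (recip δ * ∣ recip c ∣)    ≡⟨ solve 3 (λ c r s → c :* (r :* s) := r :* (c :* s)) refl (∣ c ∣) (recip δ) (∣ recip c ∣) ⟩
      recip δ * (∣ c ∣ * ∣ recip c ∣)    ≡⟨ cong (recip δ *_) (trans (sym (∣p*q∣≡∣p∣*∣q∣ c (recip c))) (cong ∣_∣ (*-recip c (nz δ≤c)))) ⟩
      recip δ * 1ℚ                      ≡⟨ *-identityʳ _ ⟩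
      recip δ                           ∎

  -- term q k = qᵏ / k!  and  partial q n = Σ_{k≤n} qᵏ / k!
  term : ℚ → ℕ → ℚ
  term q zero    = 1ℚ
  term q (suc k) = term q k * (q * unit k)

  partial : ℚ → ℕ → ℚ
  partial q zero    = 1ℚ
  partial q (suc n) = partial q n + term q (suc n)

  term-nonneg : ∀ {q} → 0ℚ ≤ q → ∀ k → 0ℚ ≤ term q k
  term-nonneg 0≤q zero    = nonNegative⁻¹ 1ℚ
  term-nonneg 0≤q (suc k) = *-nonneg (term-nonneg 0≤q k) (*-nonneg 0≤q (0≤unit k))

  term-rec : ∀ q k → fromℕ (suc k) * term q (suc k) ≡ term q k * q
  term-rec q k = begin
    fromℕ (suc k) * (term q k * (q * unit k))  ≡⟨ solve 4 (λ n t q u → n :* (t :* (q :* u)) := t :* q :* (n :* u)) refl (fromℕ (suc k)) (term q k) q (unit k) ⟩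
    term q k * q * (fromℕ (suc k) * unit k)    ≡⟨ cong (term q k * q *_) (fromℕ*unit k) ⟩
    term q k * q * 1ℚ                          ≡⟨ *-identityʳ _ ⟩
    term q k * q                               ∎
    where open ≡-Reasoning

  ∣unit∣ : ∀ k → ∣ unit k ∣ ≡ unit k
  ∣unit∣ k = 0≤p⇒∣p∣≡p (0≤unit k)

  ∣term∣ : ∀ q k → ∣ term q k ∣ ≡ term ∣ q ∣ k
  ∣term∣ q zero    = refl
  ∣term∣ q (suc k) = trans (∣p*q∣≡∣p∣*∣q∣ (term q k) (q * unit k))
    (cong₂ _*_ (∣term∣ q k) (trans (∣p*q∣≡∣p∣*∣q∣ q (unit k)) (cong (∣ q ∣ *_) (∣unit∣ k))))

  term-mono : ∀ {p q} → 0ℚ ≤ p → p ≤ q → ∀ k → term p k ≤ term q k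
  term-mono 0≤p p≤q zero    = ≤-refl
  term-mono 0≤p p≤q (suc k) = *-mono (term-nonneg 0≤p k) (term-mono 0≤p p≤q k)
    (*-nonneg 0≤p (0≤unit k)) (*-monoʳ-≤-nonNeg (unit k) {{ℚ.nonNegative (0≤unit k)}} p≤q)

  module _ {M p q : ℚ} (p≤M : ∣ p ∣ ≤ M) (q≤M : ∣ q ∣ ≤ M) where
    private
      0≤M : 0ℚ ≤ M
      0≤M = ≤-trans (0≤∣p∣ p) p≤M

    ∣term∣≤ : ∀ k → ∣ term p k ∣ ≤ term M k
    ∣term∣≤ k = subst (_≤ term M k) (sym (∣term∣ p k)) (term-mono (0≤∣p∣ p) p≤M k)

    term-lip : ∀ k → ∣ term p (suc k) - term q (suc k) ∣ ≤ term M k * ∣ p - q ∣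
    term-lip k = subst (_≤ term M k * ∣ p - q ∣) eq bound
      where
      open ≤-Reasoning
      X = term p k * p - term q k * q
      eq : unit k * ∣ X ∣ ≡ ∣ term p (suc k) - term q (suc k) ∣
      eq = trans (cong (_* ∣ X ∣) (sym (∣unit∣ k))) (trans (sym (∣p*q∣≡∣p∣*∣q∣ (unit k) X))
        (cong ∣_∣ (solve 5 (λ u a b p q → u :* (a :* p :- b :* q) := a :* (p :* u) :- b :* (q :* u)) refl (unit k) (term p k) (term q k) p q)))
      D = ∣ p - q ∣
      step : ∀ k → ∣ term p k * p - term q k * q ∣ ≤ fromℕ (suc k) * (term M k * D)
      step zero    = ≤-reflexive (trans (cong ∣_∣ (cong₂ _-_ (*-identityˡ p) (*-identityˡ q))) (sym (trans (*-identityˡ _) (*-identityˡ _))))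
      step (suc k) = begin
        ∣ term p (suc k) * p - term q (suc k) * q ∣
          ≤⟨ ∣*-*∣ (term p (suc k)) p (term q (suc k)) q ⟩
        ∣ term p (suc k) ∣ * D + ∣ q ∣ * ∣ term p (suc k) - term q (suc k) ∣
          ≤⟨ +-mono-≤ (*-monoʳ-≤-nonNeg D {{∣-∣-nonNeg (p - q)}} (∣term∣≤ (suc k)))
                      (*-mono (0≤∣p∣ q) q≤M (0≤∣p∣ (term p (suc k) - term q (suc k))) (term-lip k)) ⟩
        term M (suc k) * D + M * (term M k * D)
          ≡⟨ cong (term M (suc k) * D +_) (trans (solve 3 (λ m t d → m :* (t :* d) := t :* m :* d) refl M (term M k) D) (cong (_* D) (sym (term-rec M k)))) ⟩
        term M (suc k) * D + fromℕ (suc k) * term M (suc k) * D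
          ≡⟨ solve 3 (λ t d n → t :* d :+ n :* t :* d := (con 1ℚ :+ n) :* (t :* d)) refl (term M (suc k)) D (fromℕ (suc k)) ⟩
        (1ℚ + fromℕ (suc k)) * (term M (suc k) * D)
          ≡⟨ cong (_* (term M (suc k) * D)) (sym (fromℕ-suc (suc k))) ⟩
        fromℕ (suc (suc k)) * (term M (suc k) * D) ∎
      bound : unit k * ∣ X ∣ ≤ term M k * D
      bound = begin
        unit k * ∣ X ∣ ≤⟨ *-monoˡ-≤-nonNeg (unit k) {{ℚ.nonNegative (0≤unit k)}} (step k) ⟩
        unit k * (fromℕ (suc k) * (term M k * D)) ≡⟨ solve 3 (λ u n x → u :* (n :* x) := n :* u :* x) refl (unit k) (fromℕ (suc k)) (term M k * D) ⟩
        fromℕ (suc k) * unit k * (term M k * D) ≡⟨ cong (_* (term M k * D)) (fromℕ*unit k) ⟩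
        1ℚ * (term M k * D) ≡⟨ *-identityˡ _ ⟩
        term M k * D ∎

    partial-lip : ∀ n → ∣ partial p n - partial q n ∣ ≤ partial M n * ∣ p - q ∣
    partial-lip n = ≤-trans
      (subst (_≤ ∣ partial p n - partial q n ∣ + term M n * D) (+-identityʳ _)
        (+-monoʳ-≤ (∣ partial p n - partial q n ∣) (*-nonneg (term-nonneg 0≤M n) (0≤∣p∣ (p - q)))))
      (strong n)
      where
      open ≤-Reasoning
      D = ∣ p - q ∣
      strong : ∀ n → ∣ partial p n - partial q n ∣ + term M n * D ≤ partial M n * D
      strong zero    = ≤-reflexive (+-identityˡ _)
      strong (suc n) = begin
        ∣ (a + b) - (c + d) ∣ + e * D
          ≡⟨ cong (λ z → ∣ z ∣ + e * D) (solve 4 (λ a b c d → (a :+ b) :- (c :+ d) := (a :- c) :+ (b :- d)) refl a b c d) ⟩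
        ∣ (a - c) + (b - d) ∣ + e * D
          ≤⟨ +-monoˡ-≤ (e * D) (∣p+q∣≤∣p∣+∣q∣ (a - c) (b - d)) ⟩
        ∣ a - c ∣ + ∣ b - d ∣ + e * D
          ≤⟨ +-monoˡ-≤ (e * D) (+-monoʳ-≤ (∣ a - c ∣) (term-lip n)) ⟩
        ∣ a - c ∣ + term M n * D + e * D
          ≤⟨ +-monoˡ-≤ (e * D) (strong n) ⟩
        partial M n * D + e * D
          ≡⟨ sym (*-distribʳ-+ D (partial M n) e) ⟩
        (partial M n + e) * D ∎
        where
        a = partial p n ; b = term p (suc n) ; c = partial q n ; d = term q (suc n) ; e = term M (suc n)

  fromℕ-mono : ∀ {m n} → m ℕ.≤ n → fromℕ m ≤ fromℕ n
  fromℕ-mono {m} m≤n with ℕ.≤⇒≤′ m≤n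
  ... | ℕ.≤′-reflexive refl = ≤-refl
  ... | ℕ.≤′-step {n} m≤′n = ≤-trans (fromℕ-mono (ℕ.≤′⇒≤ m≤′n))
    (subst₂ _≤_ (+-identityˡ (fromℕ n)) (sym (fromℕ-suc n)) (+-monoˡ-≤ (fromℕ n) (nonNegative⁻¹ 1ℚ)))

  module _ {M : ℚ} (0≤M : 0ℚ ≤ M) where
    private
      K : ℕ
      K = proj₁ (arch (M + M))

      M+M≤ : ∀ {k} → K ℕ.≤ k → M + M ≤ fromℕ (suc k)
      M+M≤ K≤k = ≤-trans (proj₂ (arch (M + M))) (fromℕ-mono (ℕ.m≤n⇒m≤1+n K≤k))

      term-halves : ∀ {k} → K ℕ.≤ k → term M (suc k) + term M (suc k) ≤ term M k
      term-halves {k} K≤k = begin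
        t * (M * unit k) + t * (M * unit k)  ≡⟨ solve 3 (λ t m u → t :* (m :* u) :+ t :* (m :* u) := t :* ((m :+ m) :* u)) refl t M (unit k) ⟩
        t * ((M + M) * unit k)               ≤⟨ *-monoˡ-≤-nonNeg t {{ℚ.nonNegative (term-nonneg 0≤M k)}}
                                                  (*-monoʳ-≤-nonNeg (unit k) {{ℚ.nonNegative (0≤unit k)}} (M+M≤ K≤k)) ⟩
        t * (fromℕ (suc k) * unit k)         ≡⟨ cong (t *_) (fromℕ*unit k) ⟩
        t * 1ℚ                               ≡⟨ *-identityʳ t ⟩
        t                                    ∎
        where
        open ≤-Reasoning
        t = term M k

      tail′ : ∀ {p} → ∣ p ∣ ≤ M → ∀ {m n} → K ℕ.≤ n → n ℕ.≤′ m →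
              ∣ partial p m - partial p n ∣ + term M m ≤ term M n
      tail′ {p} p≤M {n = n} K≤n (ℕ.≤′-reflexive refl) =
        ≤-reflexive (trans (cong (λ z → ∣ z ∣ + term M n) (+-inverseʳ (partial p n))) (+-identityˡ _))
      tail′ {p} p≤M {n = n} K≤n (ℕ.≤′-step {m} n≤m) = begin
        ∣ (a + b) - c ∣ + T            ≡⟨ cong (λ z → ∣ z ∣ + T) (solve 3 (λ a b c → a :+ b :- c := (a :- c) :+ b) refl a b c) ⟩
        ∣ (a - c) + b ∣ + T            ≤⟨ +-monoˡ-≤ T (∣p+q∣≤∣p∣+∣q∣ (a - c) b) ⟩
        ∣ a - c ∣ + ∣ b ∣ + T          ≤⟨ +-monoˡ-≤ T (+-monoʳ-≤ (∣ a - c ∣) (∣term∣≤ p≤M p≤M (suc m))) ⟩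
        ∣ a - c ∣ + T + T              ≡⟨ +-assoc (∣ a - c ∣) T T ⟩
        ∣ a - c ∣ + (T + T)            ≤⟨ +-monoʳ-≤ (∣ a - c ∣) (term-halves (ℕ.≤-trans K≤n (ℕ.≤′⇒≤ n≤m))) ⟩
        ∣ a - c ∣ + term M m           ≤⟨ tail′ p≤M K≤n n≤m ⟩
        term M n                       ∎
        where
        open ≤-Reasoning
        a = partial p m ; b = term p (suc m) ; c = partial p n ; T = term M (suc m)

      ≤-+ʳ : ∀ a {b} → 0ℚ ≤ b → a ≤ a + b
      ≤-+ʳ a {b} 0≤b = subst (_≤ a + b) (+-identityʳ a) (+-monoʳ-≤ a 0≤b)

      term-antitone : ∀ {m n} → K ℕ.≤ n → n ℕ.≤′ m → term M m ≤ term M n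
      term-antitone K≤n (ℕ.≤′-reflexive refl) = ≤-refl
      term-antitone K≤n (ℕ.≤′-step {m} n≤m) = ≤-trans (≤-+ʳ (term M (suc m)) (term-nonneg 0≤M (suc m)))
        (≤-trans (term-halves (ℕ.≤-trans K≤n (ℕ.≤′⇒≤ n≤m))) (term-antitone K≤n n≤m))

    tail : ∃[ N ] ∀ {p} → ∣ p ∣ ≤ M → ∀ {m n} → N ℕ.≤ n → n ℕ.≤ m → ∣ partial p m - partial p n ∣ ≤ term M n
    tail = K , λ {p} p≤M {m} {n} K≤n n≤m → ≤-trans
      (≤-+ʳ (∣ partial p m - partial p n ∣) (term-nonneg 0≤M m)) (tail′ p≤M K≤n (ℕ.≤⇒≤′ n≤m))

    partial-bound : ∃[ C ] 0ℚ ≤ C × ∃[ N ] ∀ n → N ℕ.≤ n → partial M n ≤ C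
    partial-bound = C , 0≤C , K , λ n K≤n → begin
      partial M n                     ≡⟨ solve 2 (λ a b → a := b :+ (a :- b)) refl (partial M n) (partial M K) ⟩
      partial M K + (partial M n - partial M K)
                                      ≤⟨ +-mono-≤ (p≤∣p∣ (partial M K)) (≤-trans (p≤∣p∣ (partial M n - partial M K)) (proj₂ tail (≤-reflexive (0≤p⇒∣p∣≡p 0≤M)) ℕ.≤-refl K≤n)) ⟩
      C                               ∎
      where
      open ≤-Reasoning
      C = ∣ partial M K ∣ + term M K
      0≤C = +-nonneg (0≤∣p∣ (partial M K)) (term-nonneg 0≤M K)

    term→0 : ∀ {ε} → 0ℚ < ε → ∃[ N ] ∀ n → N ℕ.≤ n → term M n ≤ ε
    term→0 {ε} 0<ε = suc (K ℕ.⊔ L) , λ where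
        (suc n) (ℕ.s≤s K⊔L≤n) → go n (ℕ.≤-trans (ℕ.m≤m⊔n K L) K⊔L≤n) (ℕ.≤-trans (ℕ.m≤n⊔m K L) K⊔L≤n)
      where
      open ≤-Reasoning
      C = term M K * M
      L = proj₁ (arch (C * recip ε))
      go : ∀ n → K ℕ.≤ n → L ℕ.≤ n → term M (suc n) ≤ ε
      go n K≤n L≤n = *-cancelˡ-≤-pos (fromℕ (suc n)) {{normalize-pos (suc n) 1}} (begin
        fromℕ (suc n) * term M (suc n)  ≡⟨ term-rec M n ⟩
        term M n * M                    ≤⟨ *-monoʳ-≤-nonNeg M {{ℚ.nonNegative 0≤M}} (term-antitone ℕ.≤-refl (ℕ.≤⇒≤′ K≤n)) ⟩
        C                               ≡⟨ sym (trans (cong (C *_) (trans (*-comm _ ε) (*-recip ε (>⇒≢0 0<ε)))) (*-identityʳ C)) ⟩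
        C * (recip ε * ε)               ≡⟨ sym (*-assoc C (recip ε) ε) ⟩
        C * recip ε * ε                 ≤⟨ *-monoʳ-≤-nonNeg ε {{ℚ.nonNegative (<⇒≤ 0<ε)}} (≤-trans (proj₂ (arch (C * recip ε))) (fromℕ-mono (ℕ.m≤n⇒m≤1+n L≤n))) ⟩
        fromℕ (suc n) * ε               ∎)

open Rational

-- Reals are Cauchy sequences of rationals; equality is the setoid relation _≈_.

Eventually : (ℕ → Set) → Set
Eventually P = ∃[ N ] ∀ n → N ℕ.≤ n → P n

Eventually₂ : (ℕ → ℕ → Set) → Set
Eventually₂ P = ∃[ N ] ∀ m n → N ℕ.≤ m → N ℕ.≤ n → P m n

_⊗_ : ∀ {P Q} → Eventually₂ P → Eventually₂ Q → Eventually₂ (λ m n → P m n × Q m n)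
(M , p) ⊗ (N , q) = M ℕ.⊔ N , λ m n ≤m ≤n →
  p m n (ℕ.m⊔n≤o⇒m≤o M N ≤m) (ℕ.m⊔n≤o⇒m≤o M N ≤n) ,
  q m n (ℕ.m⊔n≤o⇒n≤o M N ≤m) (ℕ.m⊔n≤o⇒n≤o M N ≤n)

both : ∀ {P} → Eventually P → Eventually₂ (λ m n → P m × P n)
both (N , p) = N , λ m n ≤m ≤n → p m ≤m , p n ≤n

map₂ : ∀ {P Q : ℕ → ℕ → Set} → (∀ {m n} → P m n → Q m n) → Eventually₂ P → Eventually₂ Q
map₂ f (N , p) = N , λ m n ≤m ≤n → f (p m n ≤m ≤n)

IsCauchy : (ℕ → ℚ) → Set
IsCauchy s = ∀ ε → 0ℚ ℚ.< ε → Eventually₂ λ m n → ∣ s m ℚ.- s n ∣ ℚ.≤ ε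

record ℝ : Set where
  constructor mkℝ
  field
    seq      : ℕ → ℚ
    isCauchy : IsCauchy seq

open ℝ public

abstract
  mkCauchy : ∀ s C → 0ℚ ℚ.≤ C →
             (∀ δ → 0ℚ ℚ.< δ → Eventually₂ λ m n → ∣ s m ℚ.- s n ∣ ℚ.≤ C ℚ.* δ) →
             IsCauchy s
  mkCauchy s C 0≤C h ε 0<ε =
    let δ , 0<δ , Cδ≤ε = shrink 0≤C 0<ε in map₂ (λ p → ℚ.≤-trans p Cδ≤ε) (h δ 0<δ)

  bounded : ∀ x → ∃[ M ] 0ℚ ℚ.≤ M × Eventually λ n → ∣ seq x n ∣ ℚ.≤ M
  bounded (mkℝ x c) = let N , p = c 1ℚ (ℚ.positive⁻¹ 1ℚ) in
    ∣ x N ∣ ℚ.+ 1ℚ , +-nonneg (ℚ.0≤∣p∣ (x N)) (ℚ.nonNegative⁻¹ 1ℚ) , N , λ n N≤n → begin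
    ∣ x n ∣                          ≡⟨ cong ∣_∣ (solve 2 (λ a b → a := b :+ (a :- b)) refl (x n) (x N)) ⟩
    ∣ x N ℚ.+ (x n ℚ.- x N) ∣         ≤⟨ ℚ.∣p+q∣≤∣p∣+∣q∣ (x N) (x n ℚ.- x N) ⟩
    ∣ x N ∣ ℚ.+ ∣ x n ℚ.- x N ∣       ≤⟨ ℚ.+-monoʳ-≤ (∣ x N ∣) (p n N N≤n ℕ.≤-refl) ⟩
    ∣ x N ∣ ℚ.+ 1ℚ                   ∎
    where open ℚ.≤-Reasoning

infix 4 _≈_ _≤_ _<_ _#_
infixl 6 _+_ _-_
infixl 7 _*_
infix 8 -_

_≈_ _≤_ _<_ _#_ : ℝ → ℝ → Set
x ≈ y = ∀ ε → 0ℚ ℚ.< ε → Eventually λ n → ∣ seq x n ℚ.- seq y n ∣ ℚ.≤ ε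
x ≤ y = ∀ ε → 0ℚ ℚ.< ε → Eventually λ n → seq x n ℚ.≤ seq y n ℚ.+ ε
x < y = ∃[ ε ] 0ℚ ℚ.< ε × Eventually λ n → seq x n ℚ.+ ε ℚ.≤ seq y n
x # y = x < y ⊎ y < x

fromℚ : ℚ → ℝ
fromℚ q = mkℝ (λ _ → q) λ ε 0<ε → 0 , λ _ _ _ _ →
  ℚ.≤-trans (ℚ.≤-reflexive (cong ∣_∣ (ℚ.+-inverseʳ q))) (ℚ.<⇒≤ 0<ε)

0ℝ 1ℝ : ℝ
0ℝ = fromℚ 0ℚ
1ℝ = fromℚ 1ℚ

nat : ℕ → ℝ
nat n = fromℚ (fromℕ n)

_+_ : ℝ → ℝ → ℝ
mkℝ x cx + mkℝ y cy = mkℝ (λ n → x n ℚ.+ y n) (mkCauchy (λ n → x n ℚ.+ y n) (1ℚ ℚ.+ 1ℚ) (ℚ.nonNegative⁻¹ (1ℚ ℚ.+ 1ℚ))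
    λ δ 0<δ → map₂ (λ {m} {n} (p , q) → step {m} {n} p q) (cx δ 0<δ ⊗ cy δ 0<δ))
  where
  open ℚ.≤-Reasoning
  step : ∀ {m n δ} → ∣ x m ℚ.- x n ∣ ℚ.≤ δ → ∣ y m ℚ.- y n ∣ ℚ.≤ δ →
         ∣ (x m ℚ.+ y m) ℚ.- (x n ℚ.+ y n) ∣ ℚ.≤ (1ℚ ℚ.+ 1ℚ) ℚ.* δ
  step {m} {n} {δ} p q = begin
    ∣ (x m ℚ.+ y m) ℚ.- (x n ℚ.+ y n) ∣
      ≡⟨ cong ∣_∣ (solve 4 (λ a b c d → (a :+ b) :- (c :+ d) := (a :- c) :+ (b :- d)) refl (x m) (y m) (x n) (y n)) ⟩
    ∣ (x m ℚ.- x n) ℚ.+ (y m ℚ.- y n) ∣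
      ≤⟨ ℚ.∣p+q∣≤∣p∣+∣q∣ (x m ℚ.- x n) (y m ℚ.- y n) ⟩
    ∣ x m ℚ.- x n ∣ ℚ.+ ∣ y m ℚ.- y n ∣
      ≤⟨ ℚ.+-mono-≤ p q ⟩
    δ ℚ.+ δ
      ≡⟨ solve 1 (λ d → d :+ d := (con 1ℚ :+ con 1ℚ) :* d) refl δ ⟩
    (1ℚ ℚ.+ 1ℚ) ℚ.* δ ∎

-_ : ℝ → ℝ
- mkℝ x cx = mkℝ (λ n → ℚ.- x n) λ ε 0<ε → map₂ (λ {m} {n} p → subst (ℚ._≤ ε)
  (trans (∣-∣-sym (x m) (x n)) (cong ∣_∣ (solve 2 (λ a b → b :- a := :- a :- :- b) refl (x m) (x n)))) p) (cx ε 0<ε)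

_-_ : ℝ → ℝ → ℝ
x - y = x + - y

_*_ : ℝ → ℝ → ℝ
x * y = mkℝ (λ n → seq x n ℚ.* seq y n) (cauchy (bounded x) (bounded y))
  where
  cauchy : ∃[ X ] 0ℚ ℚ.≤ X × Eventually (λ n → ∣ seq x n ∣ ℚ.≤ X) →
           ∃[ Y ] 0ℚ ℚ.≤ Y × Eventually (λ n → ∣ seq y n ∣ ℚ.≤ Y) →
           IsCauchy (λ n → seq x n ℚ.* seq y n)
  cauchy (X , 0≤X , bX) (Y , 0≤Y , bY) = mkCauchy (λ n → seq x n ℚ.* seq y n) (X ℚ.+ Y) (+-nonneg 0≤X 0≤Y) λ δ 0<δ →
    map₂ (λ {m} {n} (((bm , _) , (_ , bn)) , (p , q)) → step {m} {n} bm bn p q)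
         ((both bX ⊗ both bY) ⊗ (isCauchy x δ 0<δ ⊗ isCauchy y δ 0<δ))
    where
    open ℚ.≤-Reasoning
    step : ∀ {m n δ} → ∣ seq x m ∣ ℚ.≤ X → ∣ seq y n ∣ ℚ.≤ Y →
           ∣ seq x m ℚ.- seq x n ∣ ℚ.≤ δ → ∣ seq y m ℚ.- seq y n ∣ ℚ.≤ δ →
           ∣ seq x m ℚ.* seq y m ℚ.- seq x n ℚ.* seq y n ∣ ℚ.≤ (X ℚ.+ Y) ℚ.* δ
    step {m} {n} {δ} bm bn p q = begin
      ∣ seq x m ℚ.* seq y m ℚ.- seq x n ℚ.* seq y n ∣
        ≤⟨ ∣*-*∣ (seq x m) (seq y m) (seq x n) (seq y n) ⟩
      ∣ seq x m ∣ ℚ.* ∣ seq y m ℚ.- seq y n ∣ ℚ.+ ∣ seq y n ∣ ℚ.* ∣ seq x m ℚ.- seq x n ∣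
        ≤⟨ ℚ.+-mono-≤ (*-mono (ℚ.0≤∣p∣ (seq x m)) bm (ℚ.0≤∣p∣ (seq y m ℚ.- seq y n)) q)
                      (*-mono (ℚ.0≤∣p∣ (seq y n)) bn (ℚ.0≤∣p∣ (seq x m ℚ.- seq x n)) p) ⟩
      X ℚ.* δ ℚ.+ Y ℚ.* δ
        ≡⟨ sym (ℚ.*-distribʳ-+ δ X Y) ⟩
      (X ℚ.+ Y) ℚ.* δ ∎

apart : ∀ {x} → x # 0ℝ → ∃[ δ ] 0ℚ ℚ.< δ × Eventually λ n → δ ℚ.≤ ∣ seq x n ∣
apart {x} (inj₁ (δ , 0<δ , N , p)) = δ , 0<δ , N , λ n N≤n → begin
  δ                                  ≡⟨ solve 2 (λ d x → d := (x :+ d) :+ :- x) refl δ (seq x n) ⟩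
  (seq x n ℚ.+ δ) ℚ.+ ℚ.- seq x n    ≤⟨ ℚ.+-monoˡ-≤ (ℚ.- seq x n) (p n N≤n) ⟩
  0ℚ ℚ.+ ℚ.- seq x n                 ≡⟨ ℚ.+-identityˡ _ ⟩
  ℚ.- seq x n                        ≤⟨ p≤∣p∣ (ℚ.- seq x n) ⟩
  ∣ ℚ.- seq x n ∣                    ≡⟨ ℚ.∣-p∣≡∣p∣ (seq x n) ⟩
  ∣ seq x n ∣                        ∎
  where open ℚ.≤-Reasoning
apart {x} (inj₂ (δ , 0<δ , N , p)) = δ , 0<δ , N , λ n N≤n →
  ℚ.≤-trans (subst (ℚ._≤ seq x n) (ℚ.+-identityˡ δ) (p n N≤n)) (p≤∣p∣ (seq x n))

inv : ∀ x → x # 0ℝ → ℝ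
inv x x#0 = mkℝ (λ n → recip (seq x n)) (cauchy (apart {x} x#0))
  where
  cauchy : ∃[ δ ] 0ℚ ℚ.< δ × Eventually (λ n → δ ℚ.≤ ∣ seq x n ∣) → IsCauchy (λ n → recip (seq x n))
  cauchy (δ , 0<δ , b) = mkCauchy (λ n → recip (seq x n)) (recip δ ℚ.* recip δ) (ℚ.<⇒≤ r*r) λ ε 0<ε →
    map₂ (λ {m} {n} ((bm , bn) , p) → ℚ.≤-trans (recip-lip 0<δ bm bn)
           (ℚ.*-monoˡ-≤-nonNeg (recip δ ℚ.* recip δ) {{ℚ.nonNegative (ℚ.<⇒≤ r*r)}} p))
         (both b ⊗ isCauchy x ε 0<ε)
    where
    r*r = *-pos (recip-pos 0<δ) (recip-pos 0<δ)

exp : ℝ → ℝ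
exp x = mkℝ (λ n → partial (seq x n) n) (cauchy (bounded x))
  where
  cauchy : ∃[ M ] 0ℚ ℚ.≤ M × Eventually (λ n → ∣ seq x n ∣ ℚ.≤ M) → IsCauchy (λ n → partial (seq x n) n)
  cauchy (M , 0≤M , b) = mkCauchy (λ n → partial (seq x n) n) (C ℚ.+ 1ℚ) (+-nonneg 0≤C (ℚ.nonNegative⁻¹ 1ℚ)) λ δ 0<δ →
    map₂ (λ {m} {n} ((bm , bn) , (cm , _) , p , q) → step {m} {n} bm bn cm p (q bn))
         (both b ⊗ (both bC ⊗ (isCauchy x δ 0<δ ⊗ small δ 0<δ)))
    where
    open ℚ.≤-Reasoning
    T  = proj₁ (tail 0≤M)
    t  = proj₂ (tail 0≤M)
    C   = proj₁ (partial-bound 0≤M)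
    0≤C = proj₁ (proj₂ (partial-bound 0≤M))
    bC  = proj₂ (proj₂ (partial-bound 0≤M))
    small : ∀ δ → 0ℚ ℚ.< δ → Eventually₂ λ m n → ∀ {p} → ∣ p ∣ ℚ.≤ M → ∣ partial p m ℚ.- partial p n ∣ ℚ.≤ δ
    small δ 0<δ = T ℕ.⊔ L , go
      where
      L = proj₁ (term→0 0≤M 0<δ)
      l = proj₂ (term→0 0≤M 0<δ)
      go : ∀ m n → T ℕ.⊔ L ℕ.≤ m → T ℕ.⊔ L ℕ.≤ n → ∀ {p} → ∣ p ∣ ℚ.≤ M → ∣ partial p m ℚ.- partial p n ∣ ℚ.≤ δ
      go m n ≤m ≤n {p} p≤M with ℕ.≤-total m n
      ... | inj₁ m≤n = subst (ℚ._≤ δ) (∣-∣-sym (partial p n) (partial p m))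
                         (ℚ.≤-trans (t p≤M (ℕ.m⊔n≤o⇒m≤o T L ≤m) m≤n) (l m (ℕ.m⊔n≤o⇒n≤o T L ≤m)))
      ... | inj₂ n≤m = ℚ.≤-trans (t p≤M (ℕ.m⊔n≤o⇒m≤o T L ≤n) n≤m) (l n (ℕ.m⊔n≤o⇒n≤o T L ≤n))
    step : ∀ {m n δ} → ∣ seq x m ∣ ℚ.≤ M → ∣ seq x n ∣ ℚ.≤ M → partial M m ℚ.≤ C →
           ∣ seq x m ℚ.- seq x n ∣ ℚ.≤ δ → ∣ partial (seq x n) m ℚ.- partial (seq x n) n ∣ ℚ.≤ δ →
           ∣ partial (seq x m) m ℚ.- partial (seq x n) n ∣ ℚ.≤ (C ℚ.+ 1ℚ) ℚ.* δ
    step {m} {n} {δ} bm bn cm p q = begin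
      ∣ partial (seq x m) m ℚ.- partial (seq x n) n ∣
        ≤⟨ ∣-∣-tri (partial (seq x m) m) (partial (seq x n) m) (partial (seq x n) n) ⟩
      ∣ partial (seq x m) m ℚ.- partial (seq x n) m ∣ ℚ.+ ∣ partial (seq x n) m ℚ.- partial (seq x n) n ∣
        ≤⟨ ℚ.+-mono-≤ (ℚ.≤-trans (partial-lip bm bn m) (ℚ.≤-trans
             (ℚ.*-monoʳ-≤-nonNeg (∣ seq x m ℚ.- seq x n ∣) {{ℚ.∣-∣-nonNeg (seq x m ℚ.- seq x n)}} cm)
             (ℚ.*-monoˡ-≤-nonNeg C {{ℚ.nonNegative 0≤C}} p))) q ⟩
      C ℚ.* δ ℚ.+ δ
        ≡⟨ solve 2 (λ c d → c :* d :+ d := (c :+ con 1ℚ) :* d) refl C δ ⟩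
      (C ℚ.+ 1ℚ) ℚ.* δ ∎

e : ℝ
e = exp 1ℝ

e#0 : e # 0ℝ
e#0 = inj₂ (1ℚ , ℚ.positive⁻¹ 1ℚ , 0 , λ n _ → ℚ.≤-trans (ℚ.≤-reflexive (ℚ.+-identityˡ 1ℚ)) (1≤ n))
  where
  1≤ : ∀ n → 1ℚ ℚ.≤ partial 1ℚ n
  1≤ zero    = ℚ.≤-refl
  1≤ (suc n) = subst (ℚ._≤ partial 1ℚ (suc n)) (ℚ.+-identityʳ 1ℚ)
    (ℚ.+-mono-≤ (1≤ n) (term-nonneg (ℚ.nonNegative⁻¹ 1ℚ) (suc n)))

IsLn : ℝ → ℝ → Set
IsLn x y = exp y ≈ x

infixl 7 _/_⟨_⟩

_/_⟨_⟩ : ℝ → (y : ℝ) → y # 0ℝ → ℝ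
x / y ⟨ y#0 ⟩ = x * inv y y#0

+-0-rawMonoid : RawMonoid 0ℓ 0ℓ
+-0-rawMonoid = record { Carrier = ℝ ; _≈_ = _≈_ ; _∙_ = _+_ ; ε = 0ℝ }

open RawMonoidDefinitions +-0-rawMonoid using (sum) public

ℝ∞ : Set
ℝ∞ = ℝ ⁺

open SupremumEquality _≈_ using (_≈⁺_) public
open SupremumStrict _<_ using (_<⁺_) public

record PartitionFunction (n : ℕ) : Set where
  field
    coeff        : Fin (suc n) → ℝ
    coeff-nonneg : ∀ i → 0ℝ ≤ coeff i
    1≤coeff₀     : 1ℝ ≤ coeff zero

open PartitionFunction public

eval : ∀ {n} → PartitionFunction n → ℝ∞ → ℝ
eval Z [ β ] = sum λ i → coeff Z i * exp (- (nat (toℕ i) * β))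
eval Z ⊤⁺    = coeff Z zero

-- extrapolate β β′ = 2β′ - β.  The case of infinite β and finite β′ never
-- arises when β < β′.
extrapolate : ℝ∞ → ℝ∞ → ℝ∞
extrapolate _     ⊤⁺     = ⊤⁺
extrapolate [ β ] [ β′ ] = [ nat 2 * β′ - β ]
extrapolate ⊤⁺    [ _ ]  = ⊤⁺

record IsSchedule {ℓ} (β : Fin (suc ℓ) → ℝ∞) : Set where
  field
    start      : β zero ≈⁺ [ 0ℝ ]
    end        : β (Fin.fromℕ ℓ) ≡ ⊤⁺
    increasing : ∀ (i : Fin ℓ) → β (inject₁ i) <⁺ β (suc i)

-- eval Z β ≥ 1 always, so the evidence Z≠0 exists at every point and
-- quantifying over it does not weaken the bound.
IsChebyshevSchedule : ∀ {ℓ n} → ℝ → PartitionFunction n → (Fin (suc ℓ) → ℝ∞) → Set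
IsChebyshevSchedule {ℓ} B Z β = IsSchedule β × ∀ (i : Fin ℓ) →
  let βᵢ   = β (inject₁ i)
      βᵢ₊₁ = β (suc i)
      Z²   = eval Z βᵢ₊₁ * eval Z βᵢ₊₁
  in (Z≠0 : Z² # 0ℝ) →
     (eval Z (extrapolate βᵢ βᵢ₊₁) * eval Z βᵢ) / Z² ⟨ Z≠0 ⟩ ≤ B

IsNonAdaptive : ∀ {ℓ} → ℕ → ℝ → ℝ → (Fin (suc ℓ) → ℝ∞) → Set
IsNonAdaptive n A B β = IsSchedule β × ∀ m → m ℕ.≤ n → (Z : PartitionFunction m) →
  eval Z [ 0ℝ ] ≈ A → 1ℝ ≤ eval Z ⊤⁺ → IsChebyshevSchedule B Z β

{-# OPTIONS --safe #-}

-- Write L = ln (A - 1) and c = ln (4B).  Test the schedule on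
-- Z(β) = p (1 + e^{s - kβ}) with s = k βᵢ + c, which is admissible as soon as
-- k βᵢ ≤ L - c.  If k βᵢ₊₁ ≥ s, then Z(βᵢ) = p (1 + 4B), Z(βᵢ₊₁) ≤ 2p and
-- Z(2βᵢ₊₁ - βᵢ) ≥ p violate the Chebyshev condition.  Hence βᵢ₊₁ - βᵢ ≤ c / k for
-- every k ≤ n with k βᵢ ≤ L - c.  The number of such k, integrated over
-- [0, L - c], is (L - c) Hₙ, and each step contributes at most c to this integral,
-- so ℓ ≥ (L / c - 1) Hₙ, while n ≤ e^{Hₙ}.
--
-- Comparisons of reals are not decidable, but ≤ is stable under double negation,
-- so case distinctions are available whenever the goal is an inequality.
module Submission where

open import Algebra.Bundles using (CommutativeRing)
import Algebra.Definitions.RawMonoid as RawMonoidDefinitions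
import Algebra.Solver.Ring as RingSolver
open import Algebra.Solver.Ring.AlmostCommutativeRing
  using (AlmostCommutativeRing; fromCommutativeRing; _-Raw-AlmostCommutative⟶_)
open import Algebra.Structures using (IsCommutativeRing)
open import Data.Fin.Base as Fin using (Fin; zero; suc; toℕ; inject₁)
import Data.Fin.Properties as Fin
open import Data.Maybe.Base using (Maybe; just; nothing)
open import Data.Nat.Base as ℕ using (ℕ; zero; suc)
import Data.Nat.Properties as ℕ
open import Data.Product.Base using (∃-syntax; _×_; _,_; proj₁; proj₂)
open import Data.Rational as ℚ using (ℚ; 0ℚ; 1ℚ; ½; ∣_∣)
import Data.Rational.Properties as ℚ
open import Data.Sum.Base using (_⊎_; inj₁; inj₂)
open import Function.Base using (_∘_)
open import Level using (0ℓ)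
open import Relation.Binary.Bundles using (Preorder)
import Relation.Binary.Construct.Add.Supremum.Equality as SupremumEquality
open import Relation.Binary.PropositionalEquality as ≡ using (_≡_)
import Relation.Binary.Reasoning.Preorder as PreorderReasoning
open import Relation.Nullary using (¬_; yes; no; contradiction)
open import Relation.Nullary.Construct.Add.Supremum using (_⁺; ⊤⁺; [_])

open import Defs using (module Rational)

-- The exponential series

-- The factor 4 in c = ln (4B) is the square of the 2 in Z(βᵢ₊₁) ≤ 2p: the steep term contributes at
-- least B (2p)² to Z(2βᵢ₊₁ - βᵢ) Z(βᵢ), and the constant term adds a surplus p² ≥ 1, which makes
-- the violation strict. The integral is never formed. For each m the affine function M Hₘ - m b
-- with M = L - c stands in for it, and the count becomes an induction on the number of remaining
-- steps and on m. Of the exponential the argument uses little more than the addition law, the value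
-- at 0 and 1 + x ≤ exp x for x ≥ 0. It is therefore carried out in an abstract ordered ring, where
-- inequalities are reduced to polynomial identities. For the Cauchy reals the addition law is the
-- laborious axiom: `exp` truncates the series at the same index at which it reads its argument, so
-- an error bound explicit in that index is needed, and the Cauchy product supplies it.

module CauchyProduct where

  open import Data.Rational using (_+_; _*_; _-_; -_; _≤_)
  open import Data.Rational.Properties
  open import Data.Rational.Solver using (module +-*-Solver)
  open import Relation.Binary.PropositionalEquality
  open +-*-Solver using (solve; _:=_; _:+_; _:*_; _:-_; con)
  open Rational

  psum : (ℕ → ℚ) → ℕ → ℚ
  psum a zero    = a zero
  psum a (suc n) = psum a n + a (suc n)

  conv : (ℕ → ℚ) → (ℕ → ℚ) → ℕ → ℚ
  conv a b zero    = a zero * b zero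
  conv a b (suc n) = a zero * b (suc n) + conv (a ∘ suc) b n

  psum-sucˡ : ∀ a n → psum a (suc n) ≡ a zero + psum (a ∘ suc) n
  psum-sucˡ a zero    = refl
  psum-sucˡ a (suc n) = trans (cong (_+ a (suc (suc n))) (psum-sucˡ a n)) (+-assoc (a zero) _ _)

  psum-cong : ∀ {a b} → (∀ n → a n ≡ b n) → ∀ n → psum a n ≡ psum b n
  psum-cong eq zero    = eq zero
  psum-cong eq (suc n) = cong₂ _+_ (psum-cong eq n) (eq (suc n))

  psum-mono : ∀ {a} → (∀ n → 0ℚ ≤ a n) → ∀ {m n} → m ℕ.≤′ n → psum a m ≤ psum a n
  psum-mono 0≤a (ℕ.≤′-reflexive refl) = ≤-refl
  psum-mono {a} 0≤a (ℕ.≤′-step {n} m≤n) = ≤-trans (psum-mono 0≤a m≤n)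
    (subst (_≤ psum a n + a (suc n)) (+-identityʳ _) (+-monoʳ-≤ (psum a n) (0≤a (suc n))))

  psum-nonneg : ∀ {a} → (∀ n → 0ℚ ≤ a n) → ∀ n → 0ℚ ≤ psum a n
  psum-nonneg 0≤a zero    = 0≤a zero
  psum-nonneg 0≤a (suc n) = +-nonneg (psum-nonneg 0≤a n) (0≤a (suc n))

  conv-cong : ∀ {a a′ b b′} → (∀ n → a n ≡ a′ n) → (∀ n → b n ≡ b′ n) → ∀ n → conv a b n ≡ conv a′ b′ n
  conv-cong p q zero    = cong₂ _*_ (p zero) (q zero)
  conv-cong p q (suc n) = cong₂ _+_ (cong₂ _*_ (p zero) (q (suc n))) (conv-cong (p ∘ suc) q n)

  conv-sucʳ : ∀ a b n → conv a b (suc n) ≡ conv a (b ∘ suc) n + a (suc n) * b zero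
  conv-sucʳ a b zero    = refl
  conv-sucʳ a b (suc n) = trans (cong (a zero * b (suc (suc n)) +_) (conv-sucʳ (a ∘ suc) b n))
    (sym (+-assoc (a zero * b (suc (suc n))) _ _))

  conv-+ˡ : ∀ a a′ b n → conv (λ i → a i + a′ i) b n ≡ conv a b n + conv a′ b n
  conv-+ˡ a a′ b zero    = *-distribʳ-+ (b zero) (a zero) (a′ zero)
  conv-+ˡ a a′ b (suc n) = trans (cong ((a zero + a′ zero) * b (suc n) +_) (conv-+ˡ (a ∘ suc) (a′ ∘ suc) b n))
    (solve 5 (λ x y z u v → (x :+ y) :* z :+ (u :+ v) := (x :* z :+ u) :+ (y :* z :+ v)) refl
      (a zero) (a′ zero) (b (suc n)) (conv (a ∘ suc) b n) (conv (a′ ∘ suc) b n))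

  conv-*ˡ : ∀ c a b n → conv (λ i → a i * c) b n ≡ c * conv a b n
  conv-*ˡ c a b zero    = solve 3 (λ c x y → x :* c :* y := c :* (x :* y)) refl c (a zero) (b zero)
  conv-*ˡ c a b (suc n) = trans (cong (a zero * c * b (suc n) +_) (conv-*ˡ c (a ∘ suc) b n))
    (solve 4 (λ c x y z → x :* c :* y :+ c :* z := c :* (x :* y :+ z)) refl c (a zero) (b (suc n)) (conv (a ∘ suc) b n))

  conv-*ʳ : ∀ c a b n → conv a (λ i → b i * c) n ≡ c * conv a b n
  conv-*ʳ c a b zero    = solve 3 (λ c x y → x :* (y :* c) := c :* (x :* y)) refl c (a zero) (b zero)
  conv-*ʳ c a b (suc n) = trans (cong (a zero * (b (suc n) * c) +_) (conv-*ʳ c (a ∘ suc) b n))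
    (solve 4 (λ c x y z → x :* (y :* c) :+ c :* z := c :* (x :* y :+ z)) refl c (a zero) (b (suc n)) (conv (a ∘ suc) b n))

  -- The Euler operator x·d/dx on coefficient sequences.
  euler : (ℕ → ℚ) → ℕ → ℚ
  euler a n = fromℕ n * a n

  euler-suc : ∀ a n → euler a (suc n) ≡ euler (a ∘ suc) n + a (suc n)
  euler-suc a n = trans (cong (_* a (suc n)) (fromℕ-suc n))
    (solve 2 (λ k x → (con 1ℚ :+ k) :* x := k :* x :+ x) refl (fromℕ n) (a (suc n)))

  -- The Leibniz rule for x·d/dx: in each summand of the convolution the weights i and n - i of the
  -- two factors add up to n. It turns the recurrences of two factors into one for their
  -- convolution.
  conv-leibniz : ∀ a b n → conv (euler a) b n + conv a (euler b) n ≡ fromℕ n * conv a b n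
  conv-leibniz a b zero    = solve 2 (λ x y → con 0ℚ :* x :* y :+ x :* (con 0ℚ :* y) := con 0ℚ :* (x :* y)) refl (a zero) (b zero)
  conv-leibniz a b (suc n) = begin
    (fromℕ 0 * x * y + conv (euler a ∘ suc) b n) + (x * (N′ * y) + conv a′ (euler b) n)
      ≡⟨ cong (λ z → (fromℕ 0 * x * y + z) + (x * (N′ * y) + conv a′ (euler b) n))
           (trans (conv-cong {b = b} (euler-suc a) (λ _ → refl) n) (conv-+ˡ (euler a′) a′ b n)) ⟩
    (fromℕ 0 * x * y + (conv (euler a′) b n + C)) + (x * (N′ * y) + conv a′ (euler b) n)
      ≡⟨ solve 6 (λ x y N′ u C v → (con 0ℚ :* x :* y :+ (u :+ C)) :+ (x :* (N′ :* y) :+ v) := (u :+ v) :+ (N′ :* (x :* y) :+ C))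
           refl x y N′ (conv (euler a′) b n) C (conv a′ (euler b) n) ⟩
    (conv (euler a′) b n + conv a′ (euler b) n) + (N′ * (x * y) + C)
      ≡⟨ cong₂ (λ u N → u + (N * (x * y) + C)) (conv-leibniz a′ b n) (fromℕ-suc n) ⟩
    fromℕ n * C + ((1ℚ + fromℕ n) * (x * y) + C)
      ≡⟨ solve 3 (λ N z C → N :* C :+ ((con 1ℚ :+ N) :* z :+ C) := (con 1ℚ :+ N) :* (z :+ C)) refl (fromℕ n) (x * y) C ⟩
    (1ℚ + fromℕ n) * (x * y + C)
      ≡⟨ cong (_* (x * y + C)) (sym (fromℕ-suc n)) ⟩
    N′ * (x * y + C) ∎
    where
    open ≡-Reasoning
    a′ = a ∘ suc
    x = a zero
    y = b (suc n)
    N′ = fromℕ (suc n)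
    C = conv a′ b n

  -- On generating functions `psum` is multiplication by 1 / (1 - x), which may be moved onto one
  -- factor of a product.
  psum-conv : ∀ a b n → psum (conv a b) n ≡ conv a (psum b) n
  psum-conv a b zero    = refl
  psum-conv a b (suc n) = begin
    psum (conv a b) n + (a zero * b (suc n) + conv a′ b n)
      ≡⟨ cong (_+ (a zero * b (suc n) + conv a′ b n)) (go n) ⟩
    (a zero * psum b n + (psum (conv a′ b) n - conv a′ b n)) + (a zero * b (suc n) + conv a′ b n)
      ≡⟨ solve 5 (λ x y z u v → (x :* y :+ (u :- v)) :+ (x :* z :+ v) := x :* (y :+ z) :+ u) refl
           (a zero) (psum b n) (b (suc n)) (psum (conv a′ b) n) (conv a′ b n) ⟩
    a zero * psum b (suc n) + psum (conv a′ b) n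
      ≡⟨ cong (a zero * psum b (suc n) +_) (psum-conv a′ b n) ⟩
    a zero * psum b (suc n) + conv a′ (psum b) n ∎
    where
    open ≡-Reasoning
    a′ = a ∘ suc
    -- The bracket is the partial sum up to n - 1; written as a difference it also covers n = 0.
    go : ∀ n → psum (conv a b) n ≡ a zero * psum b n + (psum (conv a′ b) n - conv a′ b n)
    go zero = solve 2 (λ x y → x := x :+ (y :- y)) refl (a zero * b zero) (a 1 * b zero)
    go (suc n) = trans (cong (_+ conv a b (suc n)) (go n))
      (solve 6 (λ x y z u v w → (x :* y :+ (u :- v)) :+ (x :* z :+ v) := x :* (y :+ z) :+ ((u :+ w) :- w)) refl
        (a zero) (psum b n) (b (suc n)) (psum (conv a′ b) n) (conv a′ b n) (conv a′ b (suc n)))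

  -- defect a b n m = Σ_{i≤n} aᵢ (Σ_{j≤m} bⱼ - Σ_{j≤n-i} bⱼ)
  defect : (ℕ → ℚ) → (ℕ → ℚ) → ℕ → ℕ → ℚ
  defect a b n m = psum a n * psum b m - conv a (psum b) n

  defect-suc : ∀ a b n m → defect a b (suc n) m ≡ a zero * (psum b m - psum b (suc n)) + defect (a ∘ suc) b n m
  defect-suc a b n m = trans (cong (λ z → z * psum b m - conv a (psum b) (suc n)) (psum-sucˡ a n))
    (solve 5 (λ x s y z c → (x :+ s) :* y :- (x :* z :+ c) := x :* (y :- z) :+ (s :* y :- c)) refl
      (a zero) (psum (a ∘ suc) n) (psum b m) (psum b (suc n)) (conv (a ∘ suc) (psum b) n))

  module _ {b B : ℕ → ℚ} (b≤B : ∀ n → ∣ b n ∣ ≤ B n) where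

    ∣psum-psum∣≤ : ∀ {m n} → n ℕ.≤′ m → ∣ psum b m - psum b n ∣ ≤ psum B m - psum B n
    ∣psum-psum∣≤ {m} (ℕ.≤′-reflexive refl) =
      ≤-reflexive (trans (cong ∣_∣ (+-inverseʳ (psum b m))) (sym (+-inverseʳ (psum B m))))
    ∣psum-psum∣≤ {_} {n} (ℕ.≤′-step {m} n≤m) = begin
      ∣ (psum b m + b (suc m)) - psum b n ∣
        ≡⟨ cong ∣_∣ (solve 3 (λ x y z → (x :+ y) :- z := (x :- z) :+ y) refl (psum b m) (b (suc m)) (psum b n)) ⟩
      ∣ (psum b m - psum b n) + b (suc m) ∣
        ≤⟨ ∣p+q∣≤∣p∣+∣q∣ (psum b m - psum b n) (b (suc m)) ⟩
      ∣ psum b m - psum b n ∣ + ∣ b (suc m) ∣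
        ≤⟨ +-mono-≤ (∣psum-psum∣≤ n≤m) (b≤B (suc m)) ⟩
      (psum B m - psum B n) + B (suc m)
        ≡⟨ solve 3 (λ x y z → (x :- z) :+ y := (x :+ y) :- z) refl (psum B m) (B (suc m)) (psum B n) ⟩
      (psum B m + B (suc m)) - psum B n ∎
      where open ≤-Reasoning

    ∣*psum-psum∣≤ : ∀ {x X m n} → ∣ x ∣ ≤ X → n ℕ.≤ m → ∣ x * (psum b m - psum b n) ∣ ≤ X * (psum B m - psum B n)
    ∣*psum-psum∣≤ {x} {X} {m} {n} x≤X n≤m = subst (_≤ X * (psum B m - psum B n)) (sym (∣p*q∣≡∣p∣*∣q∣ x (psum b m - psum b n)))
      (*-mono (0≤∣p∣ x) x≤X (0≤∣p∣ (psum b m - psum b n)) (∣psum-psum∣≤ (ℕ.≤⇒≤′ n≤m)))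

    -- As n ≤ m, every bracket in `defect` is a sum of entries of `b`, so the triangle inequality
    -- applies summand by summand. This reduces the error for arbitrary signs to that of the
    -- dominating series.
    ∣defect∣≤ : ∀ {a A} → (∀ n → ∣ a n ∣ ≤ A n) → ∀ {n m} → n ℕ.≤ m → ∣ defect a b n m ∣ ≤ defect A B n m
    ∣defect∣≤ {a} {A} a≤A {zero} {m} n≤m = subst₂ (λ x y → ∣ x ∣ ≤ y)
      (solve 3 (λ x y z → x :* (y :- z) := x :* y :- x :* z) refl (a zero) (psum b m) (b zero))
      (solve 3 (λ x y z → x :* (y :- z) := x :* y :- x :* z) refl (A zero) (psum B m) (B zero))
      (∣*psum-psum∣≤ (a≤A zero) n≤m)
    ∣defect∣≤ {a} {A} a≤A {suc n} {m} n≤m = subst₂ (λ x y → ∣ x ∣ ≤ y) (sym (defect-suc a b n m)) (sym (defect-suc A B n m))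
      (≤-trans (∣p+q∣≤∣p∣+∣q∣ (a zero * (psum b m - psum b (suc n))) (defect (a ∘ suc) b n m))
        (+-mono-≤ (∣*psum-psum∣≤ (a≤A zero) n≤m) (∣defect∣≤ (a≤A ∘ suc) (ℕ.≤-trans (ℕ.n≤1+n n) n≤m))))

  conv-nonneg : ∀ {a b} → (∀ n → 0ℚ ≤ a n) → (∀ n → 0ℚ ≤ b n) → ∀ n → 0ℚ ≤ conv a b n
  conv-nonneg 0≤a 0≤b zero    = *-nonneg (0≤a zero) (0≤b zero)
  conv-nonneg 0≤a 0≤b (suc n) = +-nonneg (*-nonneg (0≤a zero) (0≤b (suc n))) (conv-nonneg (0≤a ∘ suc) 0≤b n)

  -- All pairs i ≤ n, j ≤ m lie in the triangle i + j ≤ n + m, and the other pairs of the triangle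
  -- contribute nonnegative terms.
  psum*psum≤ : ∀ {a b} → (∀ n → 0ℚ ≤ a n) → (∀ n → 0ℚ ≤ b n) → ∀ n m →
               psum a n * psum b m ≤ conv a (psum b) (n ℕ.+ m)
  psum*psum≤ 0≤a 0≤b zero zero = ≤-refl
  psum*psum≤ {a} {b} 0≤a 0≤b zero (suc m) = subst (_≤ conv a (psum b) (suc m)) (+-identityʳ _)
    (+-monoʳ-≤ (a zero * psum b (suc m)) (conv-nonneg (0≤a ∘ suc) (psum-nonneg 0≤b) m))
  psum*psum≤ {a} {b} 0≤a 0≤b (suc n) m = begin
    psum a (suc n) * psum b m                          ≡⟨ cong (_* psum b m) (psum-sucˡ a n) ⟩
    (a zero + psum (a ∘ suc) n) * psum b m             ≡⟨ *-distribʳ-+ (psum b m) (a zero) _ ⟩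
    a zero * psum b m + psum (a ∘ suc) n * psum b m
      ≤⟨ +-mono-≤ (*-monoˡ-≤-nonNeg (a zero) {{ℚ.nonNegative (0≤a zero)}} (psum-mono 0≤b (ℕ.≤⇒≤′ (ℕ.m≤n+m m (suc n)))))
                  (psum*psum≤ (0≤a ∘ suc) 0≤b n m) ⟩
    conv a (psum b) (suc n ℕ.+ m)                      ∎
    where open ≤-Reasoning

  psum-term : ∀ q n → psum (term q) n ≡ partial q n
  psum-term q zero    = refl
  psum-term q (suc n) = cong (_+ term q (suc n)) (psum-term q n)

  -- Both sides satisfy (n + 1) xₙ₊₁ = (p + q) xₙ.
  conv-term : ∀ p q n → conv (term p) (term q) n ≡ term (p + q) n
  conv-term p q zero    = refl
  conv-term p q (suc n) = begin
    C                                  ≡⟨ sym (*-identityˡ C) ⟩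
    1ℚ * C                             ≡⟨ cong (_* C) (sym (fromℕ*unit n)) ⟩
    fromℕ (suc n) * unit n * C         ≡⟨ solve 3 (λ k u c → k :* u :* c := u :* (k :* c)) refl (fromℕ (suc n)) (unit n) C ⟩
    unit n * (fromℕ (suc n) * C)       ≡⟨ cong (unit n *_) (sym (conv-leibniz (term p) (term q) (suc n))) ⟩
    unit n * ((fromℕ 0 * 1ℚ * term q (suc n) + conv (euler (term p) ∘ suc) (term q) n) + conv (term p) (euler (term q)) (suc n))
      ≡⟨ cong₂ (λ u v → unit n * ((fromℕ 0 * 1ℚ * term q (suc n) + u) + v))
           (trans (conv-cong {b = term q} (term-rec p) (λ _ → refl) n) (conv-*ˡ p (term p) (term q) n))
           (trans (conv-sucʳ (term p) (euler (term q)) n)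
             (cong (_+ term p (suc n) * (fromℕ 0 * 1ℚ))
               (trans (conv-cong {a = term p} (λ _ → refl) (term-rec q) n) (conv-*ʳ q (term p) (term q) n)))) ⟩
    unit n * ((fromℕ 0 * 1ℚ * term q (suc n) + p * D) + (q * D + term p (suc n) * (fromℕ 0 * 1ℚ)))
      ≡⟨ solve 6 (λ u p q s t d → u :* ((con 0ℚ :* con 1ℚ :* t :+ p :* d) :+ (q :* d :+ s :* (con 0ℚ :* con 1ℚ))) := d :* ((p :+ q) :* u)) refl
           (unit n) p q (term p (suc n)) (term q (suc n)) D ⟩
    D * ((p + q) * unit n)             ≡⟨ cong (_* ((p + q) * unit n)) (conv-term p q n) ⟩
    term (p + q) n * ((p + q) * unit n) ∎
    where
    open ≡-Reasoning
    C = conv (term p) (term q) (suc n)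
    D = conv (term p) (term q) n

  conv-partial : ∀ p q n → conv (term p) (psum (term q)) n ≡ partial (p + q) n
  conv-partial p q n = trans (sym (psum-conv (term p) (term q) n))
    (trans (psum-cong (conv-term p q) n) (psum-term (p + q) n))

  defect-term : ∀ p q n m → defect (term p) (term q) n m ≡ partial p n * partial q m - partial (p + q) n
  defect-term p q n m = cong₂ _-_ (cong₂ _*_ (psum-term p n) (psum-term q m)) (conv-partial p q n)

  -- The product of truncated sums runs over a square of indices, the truncated series of `p + q`
  -- over a triangle inside it. The difference is dominated by the case p = q = M, where the square
  -- in turn lies in the triangle of side 2n; what is left is the piece of the series for 2M between
  -- n and 2n.
  partial-+ : ∀ {M p q} → ∣ p ∣ ≤ M → ∣ q ∣ ≤ M → ∀ n →
              ∣ partial p n * partial q n - partial (p + q) n ∣ ≤ partial (M + M) (n ℕ.+ n) - partial (M + M) n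
  partial-+ {M} {p} {q} p≤M q≤M n = begin
    ∣ partial p n * partial q n - partial (p + q) n ∣  ≡⟨ cong ∣_∣ (sym (defect-term p q n n)) ⟩
    ∣ defect (term p) (term q) n n ∣                   ≤⟨ ∣defect∣≤ (∣term∣≤ q≤M q≤M) (∣term∣≤ p≤M p≤M) (ℕ.≤-refl {n}) ⟩
    defect (term M) (term M) n n
      ≤⟨ +-monoˡ-≤ (- conv (term M) (psum (term M)) n) (psum*psum≤ (term-nonneg 0≤M) (term-nonneg 0≤M) n n) ⟩
    conv (term M) (psum (term M)) (n ℕ.+ n) - conv (term M) (psum (term M)) n
      ≡⟨ cong₂ _-_ (conv-partial M M (n ℕ.+ n)) (conv-partial M M n) ⟩
    partial (M + M) (n ℕ.+ n) - partial (M + M) n      ∎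
    where
    open ≤-Reasoning
    0≤M = ≤-trans (0≤∣p∣ p) p≤M

-- Ordered rings with an exponential

harmonic : ℕ → ℚ
harmonic zero    = 0ℚ
harmonic (suc n) = harmonic n ℚ.+ Rational.unit n

-- Constants are written ι q throughout, so that the solver can compute with them.
record RawExpOrderedRing : Set₁ where
  constructor mkRaw
  infix 4 _≈_ _≤_
  infixl 6 _+_
  infixl 7 _*_
  infix 8 -_
  field
    R       : Set
    _≈_ _≤_ : R → R → Set
    _+_ _*_ : R → R → R
    -_      : R → R
    ι       : ℚ → R
    exp     : R → R

-- The axioms are cut to what the Cauchy reals satisfy constructively: totality only under double
-- negation, inverses only from 1 upwards, where apartness from 0 is automatic.
record IsExpOrderedRing (raw : RawExpOrderedRing) : Set where
  open RawExpOrderedRing raw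
  field
    isCommutativeRing : IsCommutativeRing _≈_ _+_ _*_ -_ (ι 0ℚ) (ι 1ℚ)
    ι-+         : ∀ p q → ι (p ℚ.+ q) ≈ (ι p + ι q)
    ι-*         : ∀ p q → ι (p ℚ.* q) ≈ (ι p * ι q)
    ι-neg       : ∀ p → ι (ℚ.- p) ≈ (- ι p)
    ι-mono      : ∀ {p q} → p ℚ.≤ q → ι p ≤ ι q
    ≤-reflexive : ∀ {x y} → x ≈ y → x ≤ y
    ≤-trans     : ∀ {x y z} → x ≤ y → y ≤ z → x ≤ z
    +-monoˡ-≤   : ∀ z {x y} → x ≤ y → (x + z) ≤ (y + z)
    *-nonneg    : ∀ {x y} → ι 0ℚ ≤ x → ι 0ℚ ≤ y → ι 0ℚ ≤ (x * y)
    1≰0         : ¬ (ι 1ℚ ≤ ι 0ℚ)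
    ≤-stable    : ∀ {x y} → ¬ ¬ (x ≤ y) → x ≤ y
    ≤-total     : ∀ x y → ¬ ¬ (x ≤ y ⊎ y ≤ x)
    inverse     : ∀ {x} → ι 1ℚ ≤ x → ∃[ y ] (x * y) ≈ ι 1ℚ
    exp-cong    : ∀ {x y} → x ≈ y → exp x ≈ exp y
    exp-+       : ∀ x y → exp (x + y) ≈ (exp x * exp y)
    exp-0       : exp (ι 0ℚ) ≈ ι 1ℚ
    1+x≤exp     : ∀ {x} → ι 0ℚ ≤ x → (ι 1ℚ + x) ≤ exp x

module ExpOrderedRingProperties (raw : RawExpOrderedRing) (isExpOrderedRing : IsExpOrderedRing raw) where

  open Rational using (fromℕ; unit; fromℕ-suc; fromℕ*unit; 0≤fromℕ; 0≤unit)
  open RawExpOrderedRing raw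
  open IsExpOrderedRing isExpOrderedRing
  open IsCommutativeRing isCommutativeRing hiding (_-_; zero)

  infixl 6 _-_
  _-_ : R → R → R
  x - y = x + - y

  private
    commutativeRing : CommutativeRing 0ℓ 0ℓ
    commutativeRing = record { isCommutativeRing = isCommutativeRing }

  open RawMonoidDefinitions (CommutativeRing.+-rawMonoid commutativeRing) using (sum)

  private
    almostRing : AlmostCommutativeRing 0ℓ 0ℓ
    almostRing = fromCommutativeRing commutativeRing

    morphism : ℚ.+-*-rawRing -Raw-AlmostCommutative⟶ almostRing
    morphism = record
      { ⟦_⟧ = ι ; +-homo = ι-+ ; *-homo = ι-* ; -‿homo = ι-neg ; 0-homo = refl ; 1-homo = refl }

    ι-weaklyDecidable : ∀ p q → Maybe (ι p ≈ ι q)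
    ι-weaklyDecidable p q with p ℚ.≟ q
    ... | yes ≡.refl = just refl
    ... | no  _      = nothing

  open RingSolver ℚ.+-*-rawRing almostRing morphism ι-weaklyDecidable
    using (solve; _:=_; _:+_; _:*_; _:-_; :-_; con)

  -- Inequalities from polynomial certificates

  ≤-refl : ∀ {x} → x ≤ x
  ≤-refl = ≤-reflexive refl

  ≤-preorder : Preorder 0ℓ 0ℓ 0ℓ
  ≤-preorder = record
    { isPreorder = record { isEquivalence = isEquivalence ; reflexive = ≤-reflexive ; trans = ≤-trans } }

  open PreorderReasoning ≤-preorder

  ≤⇒0≤- : ∀ {x y} → x ≤ y → ι 0ℚ ≤ y - x
  ≤⇒0≤- {x} {y} x≤y = begin
    ι 0ℚ   ≈⟨ solve 1 (λ x → con 0ℚ := x :- x) refl x ⟩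
    x - x  ≲⟨ +-monoˡ-≤ (- x) x≤y ⟩
    y - x  ∎

  0≤-⇒≤ : ∀ {x y} → ι 0ℚ ≤ y - x → x ≤ y
  0≤-⇒≤ {x} {y} 0≤y-x = begin
    x            ≈⟨ solve 1 (λ x → x := con 0ℚ :+ x) refl x ⟩
    ι 0ℚ + x     ≲⟨ +-monoˡ-≤ x 0≤y-x ⟩
    (y - x) + x  ≈⟨ solve 2 (λ x y → (y :- x) :+ x := y) refl x y ⟩
    y            ∎

  +-nonneg : ∀ {x y} → ι 0ℚ ≤ x → ι 0ℚ ≤ y → ι 0ℚ ≤ x + y
  +-nonneg {x} {y} 0≤x 0≤y = begin
    ι 0ℚ      ≲⟨ 0≤y ⟩
    y         ≈⟨ solve 1 (λ y → y := con 0ℚ :+ y) refl y ⟩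
    ι 0ℚ + y  ≲⟨ +-monoˡ-≤ y 0≤x ⟩
    x + y     ∎

  -- The certificate `z` is an evidently nonnegative expression; the equation is left to the ring
  -- solver.
  ≤-by : ∀ {x y z} → ι 0ℚ ≤ z → z ≈ y - x → x ≤ y
  ≤-by 0≤z eq = 0≤-⇒≤ (≤-trans 0≤z (≤-reflexive eq))

  -- The solver knows nothing of relations such as `x * y ≈ ι 1ℚ`. With `t` as the cofactor of the
  -- relation, a plain polynomial identity remains.
  modulo : ∀ {x y u v} t → u ≈ v → x ≈ y + t * (u - v) → x ≈ y
  modulo {x} {y} {u} {v} t u≈v eq = trans eq (trans
    (+-congˡ (*-congˡ (+-congʳ u≈v)))
    (solve 3 (λ y t v → y :+ t :* (v :- v) := y) refl y t v))

  ≤-⇒+≤ : ∀ {x y z} → x ≤ z - y → x + y ≤ z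
  ≤-⇒+≤ {x} {y} {z} h = ≤-by (≤⇒0≤- h) (solve 3 (λ x y z → (z :- y) :- x := z :- (x :+ y)) refl x y z)

  ≤+ˡ : ∀ {x y} → ι 0ℚ ≤ y → x ≤ x + y
  ≤+ˡ {x} {y} 0≤y = ≤-by 0≤y (solve 2 (λ x y → y := (x :+ y) :- x) refl x y)

  drop-≈0 : ∀ {x y z b} → x ≤ y * b + z → b ≈ ι 0ℚ → x ≤ z
  drop-≈0 {x} {y} {z} {b} h b≈0 = ≤-trans h (≤-reflexive (modulo y b≈0
    (solve 3 (λ y b z → y :* b :+ z := z :+ y :* (b :- con 0ℚ)) refl y b z)))

  +0* : ∀ {x y} → x + ι 0ℚ * y ≈ x
  +0* {x} {y} = solve 2 (λ x y → x :+ con 0ℚ :* y := x) refl x y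

  *-monoˡ-≤ : ∀ {x y z} → ι 0ℚ ≤ z → x ≤ y → z * x ≤ z * y
  *-monoˡ-≤ {x} {y} {z} 0≤z x≤y = ≤-by (*-nonneg 0≤z (≤⇒0≤- x≤y))
    (solve 3 (λ x y z → z :* (y :- x) := z :* y :- z :* x) refl x y z)

  square-nonneg : ∀ x → ι 0ℚ ≤ x * x
  square-nonneg x = ≤-stable λ k → ≤-total (ι 0ℚ) x λ where
    (inj₁ 0≤x) → k (*-nonneg 0≤x 0≤x)
    (inj₂ x≤0) → k (≤-trans (*-nonneg (≤⇒0≤- x≤0) (≤⇒0≤- x≤0))
      (≤-reflexive (solve 1 (λ x → (con 0ℚ :- x) :* (con 0ℚ :- x) := x :* x) refl x)))

  inverse-nonneg : ∀ {x y} → ι 0ℚ ≤ x → x * y ≈ ι 1ℚ → ι 0ℚ ≤ y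
  inverse-nonneg {x} {y} 0≤x xy≈1 = ≤-trans (*-nonneg (square-nonneg y) 0≤x)
    (≤-reflexive (modulo y xy≈1 (solve 2 (λ x y → y :* y :* x := y :+ y :* (x :* y :- con 1ℚ)) refl x y)))

  -- Clears the denominator of the Chebyshev condition, with `i` standing for 1 / y.
  quotient-bound : ∀ {x y i B} → ι 0ℚ ≤ y → y * i ≈ ι 1ℚ → x * i ≤ B → x ≤ B * y
  quotient-bound {x} {y} {i} {B} 0≤y yi≈1 xi≤B = ≤-by (*-nonneg 0≤y (≤⇒0≤- xi≤B))
    (modulo (- x) yi≈1
      (solve 4 (λ x y i B → y :* (B :- x :* i) := (B :* y :- x) :+ :- x :* (y :* i :- con 1ℚ)) refl x y i B))

  1≤square : ∀ {x} → ι 1ℚ ≤ x → ι 1ℚ ≤ x * x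
  1≤square {x} 1≤x = ≤-by (*-nonneg (≤⇒0≤- 1≤x) (+-nonneg (≤⇒0≤- 1≤x) (ι-mono (0≤fromℕ 2))))
    (solve 1 (λ x → (x :- con 1ℚ) :* ((x :- con 1ℚ) :+ con (fromℕ 2)) := x :* x :- con 1ℚ) refl x)

  -- Positivity, monotonicity and order reflection of the exponential

  exp-nonneg : ∀ x → ι 0ℚ ≤ exp x
  exp-nonneg x = begin
    -- The bound `1+x≤exp` is silent on negative arguments, hence the square of exp (x / 2).
    ι 0ℚ                              ≲⟨ square-nonneg (exp (ι ½ * x)) ⟩
    exp (ι ½ * x) * exp (ι ½ * x)     ≈⟨ exp-+ (ι ½ * x) (ι ½ * x) ⟨
    exp (ι ½ * x + ι ½ * x)           ≈⟨ exp-cong (solve 1 (λ x → con ½ :* x :+ con ½ :* x := x) refl x) ⟩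
    exp x                             ∎

  exp-split : ∀ x y → exp y ≈ exp x * exp (y - x)
  exp-split x y = trans (exp-cong (solve 2 (λ x y → y := x :+ (y :- x)) refl x y)) (exp-+ x (y - x))

  exp-linear : ∀ {x y} → x ≤ y → exp x * (ι 1ℚ + (y - x)) ≤ exp y
  exp-linear {x} {y} x≤y = ≤-trans (*-monoˡ-≤ (exp-nonneg x) (1+x≤exp (≤⇒0≤- x≤y)))
    (≤-reflexive (sym (exp-split x y)))

  exp-mono : ∀ {x y} → x ≤ y → exp x ≤ exp y
  exp-mono {x} {y} x≤y = ≤-trans
    (≤-by (*-nonneg (exp-nonneg x) (≤⇒0≤- x≤y))
      (solve 2 (λ e d → e :* d := e :* (con 1ℚ :+ d) :- e) refl (exp x) (y - x)))
    (exp-linear x≤y)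

  exp-cancel-≤ : ∀ {x y} → exp x ≤ exp y → x ≤ y
  exp-cancel-≤ {x} {y} ex≤ey = ≤-stable λ k → ≤-total x y λ where
      (inj₁ x≤y) → k x≤y
      -- Here exp y (1 + (x - y)) ≤ exp x ≤ exp y; multiplying by exp (- y) leaves x - y ≤ 0.
      (inj₂ y≤x) → k (≤-by (*-nonneg (exp-nonneg (- y)) (≤⇒0≤- (≤-trans (exp-linear y≤x) ex≤ey)))
        (modulo (y - x) exp-inverse
          (solve 4 (λ x y e f → f :* (e :- e :* (con 1ℚ :+ (x :- y))) := (y :- x) :+ (y :- x) :* (e :* f :- con 1ℚ))
          refl x y (exp y) (exp (- y)))))
    where
    exp-inverse : exp y * exp (- y) ≈ ι 1ℚ
    exp-inverse = trans (sym (exp-+ y (- y)))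
      (trans (exp-cong (solve 1 (λ y → y :- y := con 0ℚ) refl y)) exp-0)

  1≤exp⇒0≤ : ∀ {x} → ι 1ℚ ≤ exp x → ι 0ℚ ≤ x
  1≤exp⇒0≤ 1≤ex = exp-cancel-≤ (≤-trans (≤-reflexive exp-0) 1≤ex)

  -- Sums with two nonzero terms, in degrees 0 and k + 1

  spike : ∀ k → R → Fin (suc k) → R
  spike zero    q zero    = q
  spike (suc k) q zero    = ι 0ℚ
  spike (suc k) q (suc i) = spike k q i

  spike-nonneg : ∀ k {q} → ι 0ℚ ≤ q → ∀ i → ι 0ℚ ≤ spike k q i
  spike-nonneg zero    0≤q zero    = 0≤q
  spike-nonneg (suc k) 0≤q zero    = ≤-refl
  spike-nonneg (suc k) 0≤q (suc i) = spike-nonneg k 0≤q i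

  sum-cong : ∀ {k} {f g : Fin k → R} → (∀ i → f i ≈ g i) → sum f ≈ sum g
  sum-cong {zero}  f≈g = refl
  sum-cong {suc k} f≈g = +-cong (f≈g zero) (sum-cong (λ i → f≈g (suc i)))

  sum-spike : ∀ k q (f : Fin (suc k) → R) → sum (λ i → spike k q i * f i) ≈ q * f (Fin.fromℕ k)
  sum-spike zero    q f = +-identityʳ _
  sum-spike (suc k) q f = trans (+-congˡ (sum-spike k q (λ i → f (suc i))))
    (solve 2 (λ x y → con 0ℚ :* x :+ y := y) refl (f zero) (q * f (Fin.fromℕ (suc k))))

  nat : ℕ → R
  nat n = ι (fromℕ n)

  nat-nonneg : ∀ n → ι 0ℚ ≤ nat n
  nat-nonneg n = ι-mono (0≤fromℕ n)

  nat-suc : ∀ n → nat (suc n) ≈ ι 1ℚ + nat n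
  nat-suc n = trans (reflexive (≡.cong ι (fromℕ-suc n))) (ι-+ 1ℚ (fromℕ n))

  nat*unit : ∀ n → nat (suc n) * ι (unit n) ≈ ι 1ℚ
  nat*unit n = trans (sym (ι-* (fromℕ (suc n)) (unit n))) (reflexive (≡.cong ι (fromℕ*unit n)))

  module _ (k : ℕ) {p q b : R} where

    sum-two-terms : ∀ f → f zero ≈ p * exp (- (nat 0 * b)) →
                    (∀ i → f (suc i) ≈ spike k q i * exp (- (nat (suc (Fin.toℕ i)) * b))) →
                    sum f ≈ p + q * exp (- (nat (suc k) * b))
    sum-two-terms f f₀ fₛ = +-cong
      (trans f₀ (trans (*-congˡ (trans (exp-cong (solve 1 (λ b → :- (con 0ℚ :* b) := con 0ℚ) refl b)) exp-0))
        (solve 1 (λ p → p :* con 1ℚ := p) refl p)))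
      (trans (sum-cong fₛ) (trans (sum-spike k q (λ i → exp (- (nat (suc (Fin.toℕ i)) * b))))
        (reflexive (≡.cong (λ j → q * exp (- (nat (suc j) * b))) (Fin.toℕ-fromℕ k)))))

    ≤two-terms : ι 0ℚ ≤ q → p ≤ p + q * exp (- (nat (suc k) * b))
    ≤two-terms 0≤q = ≤-by (*-nonneg 0≤q (exp-nonneg _))
        (solve 2 (λ p x → x := (p :+ x) :- p) refl p (q * exp (- (nat (suc k) * b))))

    two-terms≤ : q * exp (- (nat (suc k) * b)) ≤ p → p + q * exp (- (nat (suc k) * b)) ≤ p + p
    two-terms≤ qe≤p = ≤-by (≤⇒0≤- qe≤p) (solve 2 (λ p x → p :- x := (p :+ p) :- (p :+ x)) refl p (q * exp (- (nat (suc k) * b))))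

    two-terms-at-0 : b ≈ ι 0ℚ → p + q * exp (- (nat (suc k) * b)) ≈ p + q
    two-terms-at-0 b≈0 = +-congˡ (trans
      (*-congˡ (trans (exp-cong (trans (-‿cong (*-congˡ b≈0))
          (solve 1 (λ k → :- (k :* con 0ℚ) := con 0ℚ) refl (nat (suc k))))) exp-0))
      (solve 1 (λ q → q :* con 1ℚ := q) refl q))

  -- Harmonic numbers against the logarithm

  suc≤exp-harmonic : ∀ n → nat (suc n) ≤ exp (ι (harmonic n))
  suc≤exp-harmonic zero    = ≤-reflexive (sym exp-0)
  suc≤exp-harmonic (suc n) = begin
    nat (suc (suc n))                        ≈⟨ nat-suc (suc n) ⟩
    -- With `unit n` = 1 / (n + 1), the ratio of consecutive integers is 1 + 1 / (n + 1), at most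
    -- exp (1 / (n + 1)).
    ι 1ℚ + nat (suc n)
      ≈⟨ sym (modulo (ι 1ℚ) (nat*unit n)
          (solve 2 (λ k u → k :* (con 1ℚ :+ u) := (con 1ℚ :+ k) :+ con 1ℚ :* (k :* u :- con 1ℚ)) refl (nat (suc n)) (ι (unit n)))) ⟩
    nat (suc n) * (ι 1ℚ + ι (unit n))        ≲⟨ *-monoˡ-≤ (nat-nonneg (suc n)) (1+x≤exp (ι-mono (0≤unit n))) ⟩
    nat (suc n) * exp (ι (unit n))           ≈⟨ *-comm (nat (suc n)) (exp (ι (unit n))) ⟩
    exp (ι (unit n)) * nat (suc n)           ≲⟨ *-monoˡ-≤ (exp-nonneg (ι (unit n))) (suc≤exp-harmonic n) ⟩
    exp (ι (unit n)) * exp (ι (harmonic n))  ≈⟨ *-comm (exp (ι (unit n))) (exp (ι (harmonic n))) ⟩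
    exp (ι (harmonic n)) * exp (ι (unit n))  ≈⟨ exp-+ (ι (harmonic n)) (ι (unit n)) ⟨
    exp (ι (harmonic n) + ι (unit n))        ≈⟨ exp-cong (ι-+ (harmonic n) (unit n)) ⟨
    exp (ι (harmonic (suc n)))               ∎

  module _ {n : ℕ} {y e⁻¹ : R} (e-inverse : exp (ι 1ℚ) * e⁻¹ ≈ ι 1ℚ) (exp-y : exp y ≈ nat n * e⁻¹) where

    private
      0≤e-1 : ι 0ℚ ≤ exp (ι 1ℚ) - ι 1ℚ
      0≤e-1 = ≤⇒0≤- (≤-trans (≤-reflexive (sym exp-0)) (exp-mono (ι-mono (ℚ.nonNegative⁻¹ 1ℚ))))

      0≤e⁻¹ : ι 0ℚ ≤ e⁻¹
      0≤e⁻¹ = inverse-nonneg (exp-nonneg (ι 1ℚ)) e-inverse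

    ln[n/e]≤harmonic : y ≤ ι (harmonic n)
    ln[n/e]≤harmonic = exp-cancel-≤ (begin
      exp y                 ≈⟨ exp-y ⟩
      nat n * e⁻¹
        ≲⟨ ≤-by (*-nonneg (*-nonneg (nat-nonneg n) 0≤e⁻¹) 0≤e-1)
             (modulo (nat n) e-inverse
                 (solve 3 (λ N e f → N :* f :* (e :- con 1ℚ) := (N :- N :* f) :+ N :* (e :* f :- con 1ℚ)) refl (nat n) (exp (ι 1ℚ)) e⁻¹)) ⟩
      nat n                 ≲⟨ ≤-by (ι-mono (ℚ.nonNegative⁻¹ 1ℚ)) (solve 1 (λ N → con 1ℚ := (con 1ℚ :+ N) :- N) refl (nat n)) ⟩
      ι 1ℚ + nat n          ≈⟨ nat-suc n ⟨
      nat (suc n)           ≲⟨ suc≤exp-harmonic n ⟩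
      exp (ι (harmonic n))  ∎)

    -- The assumption ln n ≥ 1 enters here: it gives n ≥ e.
    0≤ln[n/e] : ∀ {x} → exp x ≈ nat n → ι 1ℚ ≤ x → ι 0ℚ ≤ y
    0≤ln[n/e] {x} exp-x 1≤x = 1≤exp⇒0≤ (begin
      ι 1ℚ         ≲⟨ ≤-by (*-nonneg 0≤e⁻¹ (≤⇒0≤- (≤-trans (exp-mono 1≤x) (≤-reflexive exp-x))))
                        (modulo (- ι 1ℚ) e-inverse
                            (solve 3 (λ N e f → f :* (N :- e) := (N :* f :- con 1ℚ) :+ :- con 1ℚ :* (e :* f :- con 1ℚ)) refl (nat n) (exp (ι 1ℚ)) e⁻¹)) ⟩
      nat n * e⁻¹  ≈⟨ exp-y ⟨
      exp y        ∎)

  -- Steep partition functions and the steps they force to be short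

  module _ {B c : R} (exp-c : exp c ≈ nat 4 * B) where

    private
      0≤B : ι 0ℚ ≤ B
      0≤B = ≤-trans (*-nonneg (ι-mono (ℚ.nonNegative⁻¹ (½ ℚ.* ½))) (≤-trans (exp-nonneg c) (≤-reflexive exp-c)))
        (≤-reflexive (solve 1 (λ B → con (½ ℚ.* ½) :* (con (fromℕ 4) :* B) := B) refl B))

    -- The constant partition function forces B ≥ 1.
    0≤ln[4B] : ∀ {A z v w i} → ι 1ℚ ≤ A → z ≈ A → v ≈ A → w ≈ A →
               (w * w) * i ≈ ι 1ℚ → (z * v) * i ≤ B → ι 0ℚ ≤ c
    0≤ln[4B] {A} {w = w} 1≤A z≈A v≈A w≈A w²i≈1 zvi≤B = 1≤exp⇒0≤ (≤-trans
      (≤-by (+-nonneg (*-nonneg (ι-mono {q = fromℕ 4} (0≤fromℕ 4)) (≤⇒0≤- 1≤B)) (ι-mono (0≤fromℕ 3)))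
        (solve 1 (λ B → con (fromℕ 4) :* (B :- con 1ℚ) :+ con (fromℕ 3) := con (fromℕ 4) :* B :- con 1ℚ) refl B))
      (≤-reflexive (sym exp-c)))
      where
      A²≤BA² : A * A ≤ B * (A * A)
      A²≤BA² = ≤-trans (≤-reflexive (sym (*-cong z≈A v≈A)))
        (≤-trans (quotient-bound (square-nonneg w) w²i≈1 zvi≤B) (≤-reflexive (*-congˡ (*-cong w≈A w≈A))))
      1≤B : ι 1ℚ ≤ B
      1≤B = ≤-stable λ k → ≤-total (ι 1ℚ) B λ where
        (inj₁ 1≤B) → k 1≤B
        -- Instead of dividing B A² - A² by A², adding (1 - B) (A² - 1) ≥ 0 turns it into B - 1.
        (inj₂ B≤1) → k (≤-by
          (+-nonneg (≤⇒0≤- A²≤BA²) (*-nonneg (≤⇒0≤- B≤1) (*-nonneg (≤⇒0≤- 1≤A) (+-nonneg (≤⇒0≤- 1≤A) (ι-mono (0≤fromℕ 2))))))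
          (solve 2 (λ A B → (B :* (A :* A) :- A :* A) :+ (con 1ℚ :- B) :* ((A :- con 1ℚ) :* ((A :- con 1ℚ) :+ con (fromℕ 2))) := B :- con 1ℚ)
              refl A B))

    -- The weights of the partition function p (1 + 4B e^{-κ(x - b)}), whose value at 0 is A.
    record SteepWeights (A κ b : R) : Set where
      field
        p q   : R
        1≤p   : ι 1ℚ ≤ p
        0≤q   : ι 0ℚ ≤ q
        p+q≈A : p + q ≈ A
        at-b  : q * exp (- (κ * b)) ≈ p * (nat 4 * B)
        after : ∀ b′ → κ * b + c ≤ κ * b′ → q * exp (- (κ * b′)) ≤ p

      0≤p : ι 0ℚ ≤ p
      0≤p = ≤-trans (ι-mono (ℚ.nonNegative⁻¹ 1ℚ)) 1≤p

      -- p (p + 4Bp) > B (2p)²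
      no-long-step : ∀ {z w} → p ≤ z → ι 0ℚ ≤ w → w ≤ p + p →
                     ¬ (z * (p + q * exp (- (κ * b))) ≤ B * (w * w))
      no-long-step {z} {w} p≤z 0≤w w≤2p zv≤Bw² = 1≰0 (≤-by
        -- Besides the assumed inequality, three nonnegative terms replace z by p, w by 2p and p² by
        -- 1. With the steep term equal to 4Bp by `at-b`, the four sum to -1.
        (+-nonneg (+-nonneg (≤⇒0≤- zv≤Bw²) (*-nonneg (≤⇒0≤- p≤z) (+-nonneg 0≤p 0≤qe)))
          (+-nonneg (*-nonneg 0≤B (*-nonneg (≤⇒0≤- w≤2p) (+-nonneg (+-nonneg 0≤p 0≤p) 0≤w)))
            (*-nonneg (≤⇒0≤- 1≤p) (+-nonneg (≤⇒0≤- 1≤p) (ι-mono (0≤fromℕ 2))))))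
        (modulo (- p) at-b
          (solve 5 (λ z w p B v →
            ((B :* (w :* w) :- z :* (p :+ v)) :+ (z :- p) :* (p :+ v))
              :+ (B :* (((p :+ p) :- w) :* ((p :+ p) :+ w)) :+ (p :- con 1ℚ) :* ((p :- con 1ℚ) :+ con (fromℕ 2)))
            := (con 0ℚ :- con 1ℚ) :+ (:- p) :* (v :- p :* (con (fromℕ 4) :* B)))
            refl z w p B (q * exp (- (κ * b))))))
        where
        0≤qe : ι 0ℚ ≤ q * exp (- (κ * b))
        0≤qe = *-nonneg 0≤q (exp-nonneg (- (κ * b)))

      not-chebyshev : ∀ {z v w i} → v ≈ p + q * exp (- (κ * b)) → p ≤ z → p ≤ w → w ≤ p + p →
                      (w * w) * i ≈ ι 1ℚ → ¬ ((z * v) * i ≤ B)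
      not-chebyshev {z} {v} {w} {i} v≈ p≤z p≤w w≤2p w²i≈1 zvi≤B =
        no-long-step p≤z (≤-trans 0≤p p≤w) w≤2p
          (≤-trans (≤-reflexive (*-congˡ (sym v≈))) (quotient-bound (square-nonneg w) w²i≈1 zvi≤B))

    -- With a = exp (κ b + c), the value A at 0 forces p = A / (1 + a) and q = a p. Then 1 ≤ p means
    -- a ≤ A - 1 = exp L, which is the assumption on κ b + c.
    steepWeights : ∀ {A L} → exp L ≈ A - ι 1ℚ → ∀ κ b → κ * b + c ≤ L → SteepWeights A κ b
    steepWeights {A} {L} exp-L κ b s≤L = record
      { p     = A * u
      ; q     = A * u * a
      ; 1≤p   = ≤-by (*-nonneg (≤⇒0≤- 1+a≤A) 0≤u)
          (modulo (- ι 1ℚ) u-inverse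
            (solve 3 (λ A a u → (A :- (con 1ℚ :+ a)) :* u := (A :* u :- con 1ℚ) :+ :- con 1ℚ :* ((con 1ℚ :+ a) :* u :- con 1ℚ))
                refl A a u))
      ; 0≤q   = *-nonneg 0≤Au 0≤a
      ; p+q≈A = modulo A u-inverse
          (solve 3 (λ A a u → A :* u :+ A :* u :* a := A :+ A :* ((con 1ℚ :+ a) :* u :- con 1ℚ)) refl A a u)
      ; at-b  = trans (*-assoc (A * u) a _) (*-congˡ (trans (sym (exp-+ (κ * b + c) (- (κ * b))))
          (trans (exp-cong (solve 2 (λ x c → (x :+ c) :- x := c) refl (κ * b) c)) exp-c)))
      ; after = λ b′ s≤κb′ → begin
          A * u * a * exp (- (κ * b′))          ≈⟨ *-assoc (A * u) a _ ⟩
          A * u * (a * exp (- (κ * b′)))        ≈⟨ *-congˡ (exp-+ (κ * b + c) (- (κ * b′))) ⟨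
          A * u * exp (κ * b + c - κ * b′)      ≲⟨ *-monoˡ-≤ 0≤Au (exp-mono (≤-by (≤⇒0≤- s≤κb′)
              (solve 2 (λ x y → x :- y := con 0ℚ :- (y :- x)) refl (κ * b′) (κ * b + c)))) ⟩
          A * u * exp (ι 0ℚ)                    ≈⟨ *-congˡ exp-0 ⟩
          A * u * ι 1ℚ                          ≈⟨ solve 1 (λ x → x :* con 1ℚ := x) refl (A * u) ⟩
          A * u                                 ∎
      }
      where
      a : R
      a = exp (κ * b + c)
      0≤a : ι 0ℚ ≤ a
      0≤a = exp-nonneg (κ * b + c)
      1+a≤A : ι 1ℚ + a ≤ A
      1+a≤A = ≤-by (≤⇒0≤- (≤-trans (exp-mono s≤L) (≤-reflexive exp-L)))
        (solve 2 (λ A a → (A :- con 1ℚ) :- a := A :- (con 1ℚ :+ a)) refl A a)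
      1≤1+a : ι 1ℚ ≤ ι 1ℚ + a
      1≤1+a = ≤-by 0≤a (solve 1 (λ a → a := (con 1ℚ :+ a) :- con 1ℚ) refl a)
      0≤1+a : ι 0ℚ ≤ ι 1ℚ + a
      0≤1+a = ≤-trans (ι-mono (ℚ.nonNegative⁻¹ 1ℚ)) 1≤1+a
      u : R
      u = proj₁ (inverse 1≤1+a)
      u-inverse : (ι 1ℚ + a) * u ≈ ι 1ℚ
      u-inverse = proj₂ (inverse 1≤1+a)
      0≤u : ι 0ℚ ≤ u
      0≤u = inverse-nonneg 0≤1+a u-inverse
      0≤Au : ι 0ℚ ≤ A * u
      0≤Au = *-nonneg (≤-trans 0≤1+a 1+a≤A) 0≤u

  -- Finiteness of `y` is part of the claim: the schedule cannot jump to infinity from a point with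
  -- κ b ≤ M.
  ShortStep : (M c κ : R) (x y : R ⁺) → Set
  ShortStep M c κ x y = ∀ b → x ≡ [ b ] → κ * b ≤ M → ∃[ b′ ] y ≡ [ b′ ] × κ * b′ ≤ κ * b + c

  -- M Hₘ - m b = Σ_{k≤m} (M / k - b) bounds the integral over [b, M] from below.
  steps≥harmonic : ∀ {M c} → ι 0ℚ ≤ c → ∀ n ℓ (β : Fin (suc ℓ) → R ⁺) → β (Fin.fromℕ ℓ) ≡ ⊤⁺ →
    (∀ i m → m ℕ.< n → ShortStep M c (nat (suc m)) (β (inject₁ i)) (β (suc i))) →
    ∀ b → β zero ≡ [ b ] → ∀ m → m ℕ.≤ n → M * ι (harmonic m) ≤ nat m * b + c * nat ℓ
  steps≥harmonic 0≤c n zero β end short b start m m≤n with () ← ≡.trans (≡.sym start) end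
  steps≥harmonic {M} {c} 0≤c n (suc ℓ) β end short b start zero m≤n =
    ≤-by (*-nonneg 0≤c (nat-nonneg (suc ℓ)))
      (solve 4 (λ M b c l → c :* l := (con 0ℚ :* b :+ c :* l) :- M :* con 0ℚ) refl M b c (nat (suc ℓ)))
  steps≥harmonic {M} {c} 0≤c n (suc ℓ) β end short b start (suc m) m<n = ≤-stable λ k →
    ≤-total M (κ * b) λ where
      -- Here M / (m + 1) ≤ b: the last summand of M Hₘ₊₁ - (m + 1) b is not positive, and the bound
      -- for `m` suffices.
      (inj₁ M≤κb) → k (begin
        M * ι (harmonic (suc m))                   ≈⟨ *-congˡ (ι-+ (harmonic m) (unit m)) ⟩
        M * (ι (harmonic m) + ι (unit m))          ≈⟨ distribˡ M _ _ ⟩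
        M * ι (harmonic m) + M * ι (unit m)
          ≲⟨ ≤-by (+-nonneg (≤⇒0≤- (steps≥harmonic 0≤c n (suc ℓ) β end short b start m (ℕ.<⇒≤ m<n)))
                            (*-nonneg (ι-mono (0≤unit m)) (≤⇒0≤- M≤κb)))
               (modulo b (nat*unit m) (modulo (- b) (nat-suc m)
                 (solve 8 (λ M h u b N K c l →
                   ((N :* b :+ c :* l) :- M :* h) :+ u :* (K :* b :- M)
                   := ((K :* b :+ c :* l) :- (M :* h :+ M :* u)) :+ b :* (K :* u :- con 1ℚ) :+ :- b :* (K :- (con 1ℚ :+ N)))
                   refl M (ι (harmonic m)) (ι (unit m)) b (nat m) κ c (nat (suc ℓ))))) ⟩
        κ * b + c * nat (suc ℓ)                    ∎)
      -- One step lowers M Hₘ₊₁ - (m + 1) b by (m + 1) (b′ - b). The short step for κ = m + 1 alone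
      -- bounds this loss by c, which the consumed step pays for.
      (inj₂ κb≤M) →
        let b′ , next , κb′≤ = short zero m m<n b start κb≤M in k (begin
        M * ι (harmonic (suc m))
          ≲⟨ steps≥harmonic 0≤c n ℓ (λ i → β (suc i)) end (λ i → short (suc i)) b′ next (suc m) m<n ⟩
        κ * b′ + c * nat ℓ                         ≲⟨ +-monoˡ-≤ (c * nat ℓ) κb′≤ ⟩
        κ * b + c + c * nat ℓ
          ≈⟨ solve 3 (λ x c l → x :+ c :+ c :* l := x :+ c :* (con 1ℚ :+ l)) refl (κ * b) c (nat ℓ) ⟩
        κ * b + c * (ι 1ℚ + nat ℓ)                 ≈⟨ +-congˡ (*-congˡ (nat-suc ℓ)) ⟨
        κ * b + c * nat (suc ℓ)                    ∎)
    where
    κ = nat (suc m)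

  -- Replacing y by H is sound only when the factor L / c - 1 is nonnegative. When it is not, 0 ≤ y
  -- makes the left side at most 0.
  length-bound : ∀ {y H c c⁻¹ L ℓ} → ι 0ℚ ≤ y → y ≤ H → ι 0ℚ ≤ c → c * c⁻¹ ≈ ι 1ℚ → ι 0ℚ ≤ ℓ →
                 (L - c) * H ≤ c * ℓ → y * (L * c⁻¹ - ι 1ℚ) ≤ ℓ
  length-bound {y} {H} {c} {c⁻¹} {L} {ℓ} 0≤y y≤H 0≤c c-inverse 0≤ℓ h = ≤-stable λ k →
    ≤-total (ι 0ℚ) ρ λ where
      (inj₁ 0≤ρ) → k (≤-by
        (+-nonneg (*-nonneg (≤⇒0≤- y≤H) 0≤ρ) (*-nonneg (inverse-nonneg 0≤c c-inverse) (≤⇒0≤- h)))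
        (modulo (ℓ + H) c-inverse
          (solve 6 (λ y H c d L l →
            (H :- y) :* (L :* d :- con 1ℚ) :+ d :* (c :* l :- (L :- c) :* H)
            := (l :- y :* (L :* d :- con 1ℚ)) :+ (l :+ H) :* (c :* d :- con 1ℚ)) refl y H c c⁻¹ L ℓ)))
      (inj₂ ρ≤0) → k (≤-by (+-nonneg 0≤ℓ (*-nonneg 0≤y (≤⇒0≤- ρ≤0)))
        (solve 3 (λ y r l → l :+ y :* (con 0ℚ :- r) := l :- y :* r) refl y ρ ℓ))
    where
    ρ = L * c⁻¹ - ι 1ℚ

open import Defs
open ≡ using (refl)

-- The reals

module RealProperties where

  open import Data.Rational.Solver using (module +-*-Solver)
  open import Relation.Binary.PropositionalEquality
  open +-*-Solver using (solve; _:=_; _:+_; _:*_; _:-_; :-_; con)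
  open Rational
  open CauchyProduct using (partial-+)

  ev-map : ∀ {P Q : ℕ → Set} → (∀ n → P n → Q n) → Eventually P → Eventually Q
  ev-map f (N , p) = N , λ n N≤n → f n (p n N≤n)

  ev-× : ∀ {P Q : ℕ → Set} → Eventually P → Eventually Q → Eventually (λ n → P n × Q n)
  ev-× (M , p) (N , q) = M ℕ.⊔ N , λ n ≤n → p n (ℕ.m⊔n≤o⇒m≤o M N ≤n) , q n (ℕ.m⊔n≤o⇒n≤o M N ≤n)

  ev-∃ : ∀ {P : ℕ → Set} → Eventually P → ∃[ n ] P n
  ev-∃ (N , p) = N , p N ℕ.≤-refl

  half-pos : ∀ {ε} → 0ℚ ℚ.< ε → 0ℚ ℚ.< ½ ℚ.* ε
  half-pos = *-pos (ℚ.positive⁻¹ ½)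

  half+half : ∀ ε → ½ ℚ.* ε ℚ.+ ½ ℚ.* ε ≡ ε
  half+half = solve 1 (λ e → con ½ :* e :+ con ½ :* e := e) refl

  ∣p-p∣≤ : ∀ {p q ε} → 0ℚ ℚ.< ε → p ≡ q → ∣ p ℚ.- q ∣ ℚ.≤ ε
  ∣p-p∣≤ {p} 0<ε refl = ℚ.≤-trans (ℚ.≤-reflexive (cong ∣_∣ (ℚ.+-inverseʳ p))) (ℚ.<⇒≤ 0<ε)

  ≤+pos : ∀ {p q ε} → 0ℚ ℚ.< ε → p ℚ.≤ q → p ℚ.≤ q ℚ.+ ε
  ≤+pos {p} {q} {ε} 0<ε p≤q = subst (ℚ._≤ q ℚ.+ ε) (ℚ.+-identityʳ p) (ℚ.+-mono-≤ p≤q (ℚ.<⇒≤ 0<ε))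

  ∣-∣≤⇒≤ : ∀ {p q ε} → ∣ p ℚ.- q ∣ ℚ.≤ ε → p ℚ.≤ q ℚ.+ ε
  ∣-∣≤⇒≤ {p} {q} {ε} h = begin
    p              ≡⟨ solve 2 (λ p q → p := q :+ (p :- q)) refl p q ⟩
    q ℚ.+ (p ℚ.- q) ≤⟨ ℚ.+-monoʳ-≤ q (ℚ.≤-trans (p≤∣p∣ (p ℚ.- q)) h) ⟩
    q ℚ.+ ε        ∎
    where open ℚ.≤-Reasoning

  ≤⇒-≤ : ∀ {p q ε} → p ℚ.≤ q ℚ.+ ε → p ℚ.- q ℚ.≤ ε
  ≤⇒-≤ {p} {q} {ε} h = begin
    p ℚ.- q          ≤⟨ ℚ.+-monoˡ-≤ (ℚ.- q) h ⟩
    (q ℚ.+ ε) ℚ.- q  ≡⟨ solve 2 (λ q e → (q :+ e) :- q := e) refl q ε ⟩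
    ε                ∎
    where open ℚ.≤-Reasoning

  ≤⇒∣-∣≤ : ∀ {p q ε} → p ℚ.≤ q ℚ.+ ε → q ℚ.≤ p ℚ.+ ε → ∣ p ℚ.- q ∣ ℚ.≤ ε
  ≤⇒∣-∣≤ {p} {q} {ε} p≤q q≤p with ℚ.∣p∣≡p∨∣p∣≡-p (p ℚ.- q)
  ... | inj₁ eq = subst (ℚ._≤ ε) (sym eq) (≤⇒-≤ p≤q)
  ... | inj₂ eq = subst (ℚ._≤ ε) (sym (trans eq (solve 2 (λ p q → :- (p :- q) := q :- p) refl p q))) (≤⇒-≤ q≤p)

  pointwise⇒≈ : ∀ x y → Eventually (λ n → seq x n ≡ seq y n) → x ≈ y
  pointwise⇒≈ x y h ε 0<ε = ev-map (λ _ → ∣p-p∣≤ 0<ε) h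

  pointwise⇒≤ : ∀ x y → Eventually (λ n → seq x n ℚ.≤ seq y n) → x ≤ y
  pointwise⇒≤ x y h ε 0<ε = ev-map (λ _ → ≤+pos 0<ε) h

  everywhere : ∀ {P : ℕ → Set} → (∀ n → P n) → Eventually P
  everywhere p = 0 , λ n _ → p n

  ≈-refl : ∀ x → x ≈ x
  ≈-refl x = pointwise⇒≈ x x (everywhere λ _ → refl)

  ≈-sym : ∀ x y → x ≈ y → y ≈ x
  ≈-sym x y h ε 0<ε = ev-map (λ n → subst (ℚ._≤ ε) (∣-∣-sym (seq x n) (seq y n))) (h ε 0<ε)

  ≈-trans : ∀ x y z → x ≈ y → y ≈ z → x ≈ z
  ≈-trans x y z p q ε 0<ε = ev-map
    (λ n (a , b) → ℚ.≤-trans (∣-∣-tri (seq x n) (seq y n) (seq z n))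
       (subst (∣ seq x n ℚ.- seq y n ∣ ℚ.+ ∣ seq y n ℚ.- seq z n ∣ ℚ.≤_) (half+half ε) (ℚ.+-mono-≤ a b)))
    (ev-× (p _ (half-pos 0<ε)) (q _ (half-pos 0<ε)))

  +-cong : ∀ x y u v → x ≈ y → u ≈ v → x + u ≈ y + v
  +-cong x y u v p q ε 0<ε = ev-map
    (λ n (a , b) → begin
      ∣ (seq x n ℚ.+ seq u n) ℚ.- (seq y n ℚ.+ seq v n) ∣
        ≡⟨ cong ∣_∣
            (solve 4 (λ x u y v → (x :+ u) :- (y :+ v) := (x :- y) :+ (u :- v)) refl (seq x n) (seq u n) (seq y n) (seq v n)) ⟩
      ∣ (seq x n ℚ.- seq y n) ℚ.+ (seq u n ℚ.- seq v n) ∣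
        ≤⟨ ℚ.∣p+q∣≤∣p∣+∣q∣ (seq x n ℚ.- seq y n) (seq u n ℚ.- seq v n) ⟩
      ∣ seq x n ℚ.- seq y n ∣ ℚ.+ ∣ seq u n ℚ.- seq v n ∣
        ≤⟨ ℚ.+-mono-≤ a b ⟩
      ½ ℚ.* ε ℚ.+ ½ ℚ.* ε
        ≡⟨ half+half ε ⟩
      ε ∎)
    (ev-× (p _ (half-pos 0<ε)) (q _ (half-pos 0<ε)))
    where open ℚ.≤-Reasoning

  -‿cong : ∀ x y → x ≈ y → - x ≈ - y
  -‿cong x y p ε 0<ε = ev-map
    (λ n → subst (ℚ._≤ ε) (trans (∣-∣-sym (seq x n) (seq y n))
      (cong ∣_∣ (solve 2 (λ x y → y :- x := :- x :- :- y) refl (seq x n) (seq y n)))))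
    (p ε 0<ε)

  *-cong : ∀ x y u v → x ≈ y → u ≈ v → x * u ≈ y * v
  *-cong x y u v p q ε 0<ε =
    let X , 0≤X , bx = bounded x
        V , 0≤V , bv = bounded v
        δ , 0<δ , Cδ≤ε = shrink {X ℚ.+ V} (+-nonneg 0≤X 0≤V) 0<ε
    in ev-map
      (λ n ((xX , vV) , (a , b)) → begin
        ∣ seq x n ℚ.* seq u n ℚ.- seq y n ℚ.* seq v n ∣
          ≤⟨ ∣*-*∣ (seq x n) (seq u n) (seq y n) (seq v n) ⟩
        ∣ seq x n ∣ ℚ.* ∣ seq u n ℚ.- seq v n ∣ ℚ.+ ∣ seq v n ∣ ℚ.* ∣ seq x n ℚ.- seq y n ∣
          ≤⟨ ℚ.+-mono-≤ (*-mono (ℚ.0≤∣p∣ (seq x n)) xX (ℚ.0≤∣p∣ (seq u n ℚ.- seq v n)) b)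
                        (*-mono (ℚ.0≤∣p∣ (seq v n)) vV (ℚ.0≤∣p∣ (seq x n ℚ.- seq y n)) a) ⟩
        X ℚ.* δ ℚ.+ V ℚ.* δ  ≡⟨ sym (ℚ.*-distribʳ-+ δ X V) ⟩
        (X ℚ.+ V) ℚ.* δ      ≤⟨ Cδ≤ε ⟩
        ε                    ∎)
      (ev-× (ev-× bx bv) (ev-× (p δ 0<δ) (q δ 0<δ)))
    where open ℚ.≤-Reasoning

  ≤-reflexive : ∀ x y → x ≈ y → x ≤ y
  ≤-reflexive x y p ε 0<ε = ev-map (λ _ → ∣-∣≤⇒≤) (p ε 0<ε)

  ≤-antisym : ∀ x y → x ≤ y → y ≤ x → x ≈ y
  ≤-antisym x y p q ε 0<ε = ev-map (λ _ (a , b) → ≤⇒∣-∣≤ a b) (ev-× (p ε 0<ε) (q ε 0<ε))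

  ≤-trans : ∀ x y z → x ≤ y → y ≤ z → x ≤ z
  ≤-trans x y z p q ε 0<ε = ev-map
    (λ n (a , b) → begin
      seq x n                                ≤⟨ a ⟩
      seq y n ℚ.+ ½ ℚ.* ε                    ≤⟨ ℚ.+-monoˡ-≤ (½ ℚ.* ε) b ⟩
      (seq z n ℚ.+ ½ ℚ.* ε) ℚ.+ ½ ℚ.* ε      ≡⟨ solve 2 (λ z e → (z :+ con ½ :* e) :+ con ½ :* e := z :+ e) refl (seq z n) ε ⟩
      seq z n ℚ.+ ε                          ∎)
    (ev-× (p _ (half-pos 0<ε)) (q _ (half-pos 0<ε)))
    where open ℚ.≤-Reasoning

  +-monoˡ-≤ : ∀ z x y → x ≤ y → x + z ≤ y + z
  +-monoˡ-≤ z x y p ε 0<ε = ev-map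
    (λ n a → ℚ.≤-trans (ℚ.+-monoˡ-≤ (seq z n) a)
      (ℚ.≤-reflexive (solve 3 (λ y e z → (y :+ e) :+ z := (y :+ z) :+ e) refl (seq y n) ε (seq z n))))
    (p ε 0<ε)

  <⇒≤ : ∀ x y → x < y → x ≤ y
  <⇒≤ x y (ε , 0<ε , h) = pointwise⇒≤ x y (ev-map
    (λ n a → ℚ.≤-trans (subst (ℚ._≤ seq x n ℚ.+ ε) (ℚ.+-identityʳ _) (ℚ.+-monoʳ-≤ (seq x n) (ℚ.<⇒≤ 0<ε))) a) h)

  <⇒≱ : ∀ x y → x < y → ¬ (y ≤ x)
  <⇒≱ x y (ε , 0<ε , h) y≤x =
    let n , a , b = ev-∃ (ev-× h (y≤x _ (half-pos 0<ε))) in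
    ℚ.<-irrefl refl (begin-strict
      0ℚ                                          <⟨ half-pos 0<ε ⟩
      ½ ℚ.* ε                                     ≡⟨ solve 2 (λ x e → con ½ :* e := (x :+ e) :- (x :+ con ½ :* e))
          refl (seq x n) ε ⟩
      (seq x n ℚ.+ ε) ℚ.- (seq x n ℚ.+ ½ ℚ.* ε)   ≤⟨ ℚ.+-monoˡ-≤ (ℚ.- (seq x n ℚ.+ ½ ℚ.* ε)) (ℚ.≤-trans a b) ⟩
      (seq x n ℚ.+ ½ ℚ.* ε) ℚ.- (seq x n ℚ.+ ½ ℚ.* ε) ≡⟨ ℚ.+-inverseʳ (seq x n ℚ.+ ½ ℚ.* ε) ⟩
      0ℚ ∎)
    where open ℚ.≤-Reasoning

  -- A comparison at one late index decides x ≤ y + ε or y < x.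
  ≮⇒≥ : ∀ x y → ¬ (x < y) → y ≤ x
  ≮⇒≥ x y x≮y ε 0<ε = go (seq y N ℚ.≤? seq x N ℚ.+ ½ ℚ.* ε)
    where
    open ℚ.≤-Reasoning
    -- Despite its name this is ε / 8. Two such errors still leave a gap ε / 4 below ε / 2 in one
    -- case, and add up to less than ε with ε / 2 in the other.
    ε/4 = ½ ℚ.* (½ ℚ.* (½ ℚ.* ε))
    0<ε/4 = half-pos (half-pos (half-pos 0<ε))
    cauchy = isCauchy x ε/4 0<ε/4 ⊗ isCauchy y ε/4 0<ε/4
    N = proj₁ cauchy
    close : ∀ m n → N ℕ.≤ m → N ℕ.≤ n → ∣ seq x m ℚ.- seq x n ∣ ℚ.≤ ε/4 × ∣ seq y m ℚ.- seq y n ∣ ℚ.≤ ε/4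
    close = proj₂ cauchy
    go : _ → Eventually λ n → seq y n ℚ.≤ seq x n ℚ.+ ε
    go (yes y≤x) = N , λ n N≤n → begin
      seq y n                                   ≤⟨ ∣-∣≤⇒≤ (proj₂ (close n N N≤n ℕ.≤-refl)) ⟩
      seq y N ℚ.+ ε/4                           ≤⟨ ℚ.+-monoˡ-≤ ε/4 y≤x ⟩
      (seq x N ℚ.+ ½ ℚ.* ε) ℚ.+ ε/4             ≤⟨ ℚ.+-monoˡ-≤ ε/4 (ℚ.+-monoˡ-≤ (½ ℚ.* ε)
          (∣-∣≤⇒≤ {seq x N} {seq x n} (proj₁ (close N n ℕ.≤-refl N≤n)))) ⟩
      ((seq x n ℚ.+ ε/4) ℚ.+ ½ ℚ.* ε) ℚ.+ ε/4   ≤⟨ ≤+pos (half-pos (half-pos 0<ε)) ℚ.≤-refl ⟩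
      (((seq x n ℚ.+ ε/4) ℚ.+ ½ ℚ.* ε) ℚ.+ ε/4) ℚ.+ ½ ℚ.* (½ ℚ.* ε)
        ≡⟨ solve 2 (λ x e → let e/4 = con ½ :* (con ½ :* (con ½ :* e)) in
             (((x :+ e/4) :+ con ½ :* e) :+ e/4) :+ con ½ :* (con ½ :* e) := x :+ e) refl (seq x n) ε ⟩
      seq x n ℚ.+ ε ∎
    go (no y≰x) = contradiction (½ ℚ.* (½ ℚ.* ε) , half-pos (half-pos 0<ε) , N , λ n N≤n → begin
      seq x n ℚ.+ ½ ℚ.* (½ ℚ.* ε)                 ≤⟨ ℚ.+-monoˡ-≤ (½ ℚ.* (½ ℚ.* ε))
          (∣-∣≤⇒≤ {seq x n} {seq x N} (proj₁ (close n N N≤n ℕ.≤-refl))) ⟩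
      (seq x N ℚ.+ ε/4) ℚ.+ ½ ℚ.* (½ ℚ.* ε)
        ≡⟨ solve 2 (λ x e → let e/4 = con ½ :* (con ½ :* (con ½ :* e)) in
             (x :+ e/4) :+ con ½ :* (con ½ :* e) := (x :+ con ½ :* e) :- e/4) refl (seq x N) ε ⟩
      (seq x N ℚ.+ ½ ℚ.* ε) ℚ.- ε/4               ≤⟨ ℚ.+-monoˡ-≤ (ℚ.- ε/4) (ℚ.<⇒≤ (ℚ.≰⇒> y≰x)) ⟩
      seq y N ℚ.- ε/4                             ≤⟨ ℚ.+-monoˡ-≤ (ℚ.- ε/4)
          (∣-∣≤⇒≤ {seq y N} {seq y n} (proj₂ (close N n ℕ.≤-refl N≤n))) ⟩
      (seq y n ℚ.+ ε/4) ℚ.- ε/4                   ≡⟨ solve 2 (λ y e → (y :+ e) :- e := y) refl (seq y n) ε/4 ⟩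
      seq y n ∎) x≮y

  ≤-stable : ∀ x y → ¬ ¬ (x ≤ y) → x ≤ y
  ≤-stable x y h = ≮⇒≥ y x λ y<x → h (<⇒≱ y x y<x)

  ≤-total : ∀ x y → ¬ ¬ (x ≤ y ⊎ y ≤ x)
  ≤-total x y k = k (inj₁ (≮⇒≥ y x λ y<x → k (inj₂ (<⇒≤ y x y<x))))

  0<⊎≈0 : ∀ x → 0ℝ ≤ x → ¬ ¬ (0ℝ < x ⊎ x ≈ 0ℝ)
  0<⊎≈0 x 0≤x k = k (inj₂ (≤-antisym x 0ℝ (≮⇒≥ 0ℝ x (k ∘ inj₁)) 0≤x))

  positive-seq : ∀ x → 0ℝ < x → Eventually λ n → 0ℚ ℚ.≤ seq x n
  positive-seq x (ε , 0<ε , h) = ev-map (λ n a → ℚ.≤-trans (≤+pos 0<ε ℚ.≤-refl) a) h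

  *-zeroˡ : ∀ x y → x ≈ 0ℝ → x * y ≈ 0ℝ
  *-zeroˡ x y x≈0 = ≈-trans (x * y) (0ℝ * y) 0ℝ (*-cong x 0ℝ y y x≈0 (≈-refl y))
    (pointwise⇒≈ (0ℝ * y) 0ℝ (everywhere λ n → ℚ.*-zeroˡ (seq y n)))

  *-comm : ∀ x y → x * y ≈ y * x
  *-comm x y = pointwise⇒≈ (x * y) (y * x) (everywhere λ n → ℚ.*-comm (seq x n) (seq y n))

  -- From 0 ≤ x the entries are only known to be at least -ε, so entrywise multiplication proves
  -- nothing. Under double negation each factor is either positive, hence eventually nonnegative
  -- entry by entry, or zero.
  *-nonnegative : ∀ x y → 0ℝ ≤ x → 0ℝ ≤ y → 0ℝ ≤ x * y
  *-nonnegative x y 0≤x 0≤y = ≤-stable 0ℝ (x * y) λ k →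
    0<⊎≈0 x 0≤x λ where
      (inj₂ x≈0) → k (≤-reflexive 0ℝ (x * y) (≈-sym (x * y) 0ℝ (*-zeroˡ x y x≈0)))
      (inj₁ 0<x) → 0<⊎≈0 y 0≤y λ where
        (inj₂ y≈0) → k (≤-reflexive 0ℝ (x * y) (≈-sym (x * y) 0ℝ
          (≈-trans (x * y) (y * x) 0ℝ (*-comm x y) (*-zeroˡ y x y≈0))))
        (inj₁ 0<y) → k (pointwise⇒≤ 0ℝ (x * y)
          (ev-map (λ n (a , b) → *-nonneg a b) (ev-× (positive-seq x 0<x) (positive-seq y 0<y))))

  1≰0 : ¬ (1ℝ ≤ 0ℝ)
  1≰0 = <⇒≱ 0ℝ 1ℝ (1ℚ , ℚ.positive⁻¹ 1ℚ , everywhere λ _ → ℚ.≤-reflexive (ℚ.+-identityˡ 1ℚ))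

  1≤⇒0< : ∀ x → 1ℝ ≤ x → 0ℝ < x
  1≤⇒0< x 1≤x = ½ , ℚ.positive⁻¹ ½ , ev-map
    (λ n a → subst₂ ℚ._≤_ refl (solve 1 (λ x → (x :+ con ½) :- con ½ := x) refl (seq x n)) (ℚ.+-monoˡ-≤ (ℚ.- ½) a))
    (1≤x ½ (ℚ.positive⁻¹ ½))

  -- As `recip` sends 0 to 0, the entrywise identity is claimed only from the index on where
  -- apartness keeps the entries away from 0.
  *-inverse : ∀ x (x#0 : x # 0ℝ) → x * inv x x#0 ≈ 1ℝ
  *-inverse x x#0 = let δ , 0<δ , h = apart {x} x#0 in
    pointwise⇒≈ (x * inv x x#0) 1ℝ
      (ev-map (λ n δ≤x → *-recip (seq x n) λ x≡0 →
         ℚ.<-irrefl refl (ℚ.<-≤-trans 0<δ (subst (λ z → δ ℚ.≤ ∣ z ∣) x≡0 δ≤x))) h)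

  fromℚ-mono : ∀ p q → p ℚ.≤ q → fromℚ p ≤ fromℚ q
  fromℚ-mono p q p≤q = pointwise⇒≤ (fromℚ p) (fromℚ q) (everywhere λ _ → p≤q)

  -- On a common bound for both sequences the truncated series are Lipschitz, with a constant
  -- bounded independently of the truncation.
  exp-cong : ∀ x y → x ≈ y → exp x ≈ exp y
  exp-cong x y x≈y ε 0<ε =
    let X , 0≤X , bx = bounded x
        Y , 0≤Y , by = bounded y
        C , 0≤C , bC = partial-bound (+-nonneg 0≤X 0≤Y)
        δ , 0<δ , Cδ≤ε = shrink 0≤C 0<ε
        X≤X+Y = ℚ.≤-trans (ℚ.≤-reflexive (sym (ℚ.+-identityʳ X))) (ℚ.+-monoʳ-≤ X 0≤Y)
        Y≤X+Y = ℚ.≤-trans (ℚ.≤-reflexive (sym (ℚ.+-identityˡ Y))) (ℚ.+-monoˡ-≤ Y 0≤X)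
    in ev-map
      (λ n ((xX , yY) , (c , a)) → begin
        ∣ partial (seq x n) n ℚ.- partial (seq y n) n ∣
          ≤⟨ partial-lip (ℚ.≤-trans xX X≤X+Y) (ℚ.≤-trans yY Y≤X+Y) n ⟩
        partial (X ℚ.+ Y) n ℚ.* ∣ seq x n ℚ.- seq y n ∣
          ≤⟨ ℚ.*-monoʳ-≤-nonNeg (∣ seq x n ℚ.- seq y n ∣) {{ℚ.∣-∣-nonNeg (seq x n ℚ.- seq y n)}} c ⟩
        C ℚ.* ∣ seq x n ℚ.- seq y n ∣
          ≤⟨ ℚ.*-monoˡ-≤-nonNeg C {{ℚ.nonNegative 0≤C}} a ⟩
        C ℚ.* δ
          ≤⟨ Cδ≤ε ⟩
        ε ∎)
      (ev-× (ev-× bx by) (ev-× bC (x≈y δ 0<δ)))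
    where open ℚ.≤-Reasoning

  -- At index n the error is a piece of the series for 2M between n and 2n. For large n it is at
  -- most the term at n, which tends to 0.
  exp-+ : ∀ x y → exp (x + y) ≈ exp x * exp y
  exp-+ x y ε 0<ε =
    let X , 0≤X , bx = bounded x
        Y , 0≤Y , by = bounded y
        M = X ℚ.+ Y
        0≤M = +-nonneg 0≤X 0≤Y
        X≤M = ℚ.≤-trans (ℚ.≤-reflexive (sym (ℚ.+-identityʳ X))) (ℚ.+-monoʳ-≤ X 0≤Y)
        Y≤M = ℚ.≤-trans (ℚ.≤-reflexive (sym (ℚ.+-identityˡ Y))) (ℚ.+-monoˡ-≤ Y 0≤X)
        0≤2M = +-nonneg 0≤M 0≤M
        T , t = tail 0≤2M
    in ev-map
      (λ n ((xX , yY) , (T≤n , small)) → begin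
        ∣ partial (seq x n ℚ.+ seq y n) n ℚ.- partial (seq x n) n ℚ.* partial (seq y n) n ∣
          ≡⟨ ∣-∣-sym (partial (seq x n ℚ.+ seq y n) n) (partial (seq x n) n ℚ.* partial (seq y n) n) ⟩
        ∣ partial (seq x n) n ℚ.* partial (seq y n) n ℚ.- partial (seq x n ℚ.+ seq y n) n ∣
          ≤⟨ partial-+ (ℚ.≤-trans xX X≤M) (ℚ.≤-trans yY Y≤M) n ⟩
        partial (M ℚ.+ M) (n ℕ.+ n) ℚ.- partial (M ℚ.+ M) n
          ≤⟨ p≤∣p∣ _ ⟩
        ∣ partial (M ℚ.+ M) (n ℕ.+ n) ℚ.- partial (M ℚ.+ M) n ∣
          ≤⟨ t (ℚ.≤-reflexive (ℚ.0≤p⇒∣p∣≡p 0≤2M)) T≤n (ℕ.m≤m+n n n) ⟩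
        term (M ℚ.+ M) n
          ≤⟨ small ⟩
        ε ∎)
      (ev-× (ev-× bx by) (ev-× (T , λ n T≤n → T≤n) (term→0 0≤2M 0<ε)))
    where open ℚ.≤-Reasoning

  partial-0 : ∀ n → partial 0ℚ n ≡ 1ℚ
  partial-0 zero    = refl
  partial-0 (suc n) = cong₂ ℚ._+_ (partial-0 n)
    (trans (cong (term 0ℚ n ℚ.*_) (ℚ.*-zeroˡ (unit n))) (ℚ.*-zeroʳ (term 0ℚ n)))

  exp-0 : exp 0ℝ ≈ 1ℝ
  exp-0 = pointwise⇒≈ (exp 0ℝ) 1ℝ (everywhere partial-0)

  1+q≤partial : ∀ {q} → 0ℚ ℚ.≤ q → ∀ n → 1ℚ ℚ.+ q ℚ.≤ partial q (suc n)
  1+q≤partial {q} 0≤q zero    = ℚ.≤-reflexive (solve 1 (λ q → con 1ℚ :+ q := con 1ℚ :+ con 1ℚ :* (q :* con 1ℚ)) refl q)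
  1+q≤partial {q} 0≤q (suc n) = subst (ℚ._≤ partial q (suc (suc n))) (ℚ.+-identityʳ (1ℚ ℚ.+ q))
    (ℚ.+-mono-≤ (1+q≤partial 0≤q n) (term-nonneg 0≤q (suc (suc n))))

  1+x≤exp : ∀ x → 0ℝ ≤ x → 1ℝ + x ≤ exp x
  1+x≤exp x 0≤x = ≤-stable (1ℝ + x) (exp x) λ k → 0<⊎≈0 x 0≤x λ where
    (inj₁ 0<x) → k (pointwise⇒≤ (1ℝ + x) (exp x)
      -- Truncation at index 0 gives the constant 1 without the linear term, so the comparison
      -- starts at index 1.
      (ev-map (λ where zero    (() , _)
                       (suc n) (_ , 0≤x) → 1+q≤partial 0≤x n)
        (ev-× {P = 1 ℕ.≤_} (1 , λ _ 1≤n → 1≤n) (positive-seq x 0<x))))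
    (inj₂ x≈0) → k (≤-reflexive (1ℝ + x) (exp x)
      (≈-trans (1ℝ + x) 1ℝ (exp x)
        (≈-trans (1ℝ + x) (1ℝ + 0ℝ) 1ℝ (+-cong 1ℝ 1ℝ x 0ℝ (≈-refl 1ℝ) x≈0)
          (pointwise⇒≈ (1ℝ + 0ℝ) 1ℝ (everywhere λ _ → ℚ.+-identityʳ 1ℚ)))
        (≈-sym (exp x) 1ℝ (≈-trans (exp x) (exp 0ℝ) 1ℝ (exp-cong x 0ℝ x≈0) exp-0))))

  isCommutativeRing : IsCommutativeRing _≈_ _+_ _*_ -_ 0ℝ 1ℝ
  isCommutativeRing = record
    { isRing = record
      { +-isAbelianGroup = record
        { isGroup = record
          { isMonoid = record
            { isSemigroup = record
              { isMagma = record
                { isEquivalence = record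
                  { refl  = λ {x} → ≈-refl x
                  ; sym   = λ {x} {y} → ≈-sym x y
                  ; trans = λ {x} {y} {z} → ≈-trans x y z
                  }
                ; ∙-cong = λ {x} {y} {u} {v} → +-cong x y u v
                }
              ; assoc = λ x y z → pointwise⇒≈ ((x + y) + z) (x + (y + z))
                  (everywhere λ n → ℚ.+-assoc (seq x n) (seq y n) (seq z n))
              }
            ; identity = (λ x → pointwise⇒≈ (0ℝ + x) x (everywhere λ n → ℚ.+-identityˡ (seq x n)))
                       , (λ x → pointwise⇒≈ (x + 0ℝ) x (everywhere λ n → ℚ.+-identityʳ (seq x n)))
            }
          ; inverse = (λ x → pointwise⇒≈ (- x + x) 0ℝ (everywhere λ n → ℚ.+-inverseˡ (seq x n)))
                    , (λ x → pointwise⇒≈ (x + - x) 0ℝ (everywhere λ n → ℚ.+-inverseʳ (seq x n)))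
          ; ⁻¹-cong = λ {x} {y} → -‿cong x y
          }
        ; comm = λ x y → pointwise⇒≈ (x + y) (y + x) (everywhere λ n → ℚ.+-comm (seq x n) (seq y n))
        }
      ; *-cong = λ {x} {y} {u} {v} → *-cong x y u v
      ; *-assoc = λ x y z → pointwise⇒≈ ((x * y) * z) (x * (y * z)) (everywhere λ n → ℚ.*-assoc (seq x n) (seq y n) (seq z n))
      ; *-identity = (λ x → pointwise⇒≈ (1ℝ * x) x (everywhere λ n → ℚ.*-identityˡ (seq x n)))
                   , (λ x → pointwise⇒≈ (x * 1ℝ) x (everywhere λ n → ℚ.*-identityʳ (seq x n)))
      ; distrib = (λ x y z → pointwise⇒≈ (x * (y + z)) (x * y + x * z)
          (everywhere λ n → ℚ.*-distribˡ-+ (seq x n) (seq y n) (seq z n)))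
                , (λ x y z → pointwise⇒≈ ((y + z) * x) (y * x + z * x)
                    (everywhere λ n → ℚ.*-distribʳ-+ (seq x n) (seq y n) (seq z n)))
      }
    ; *-comm = *-comm
    }

open RealProperties

-- Testing the schedule on two-term partition functions

ℝ-isExpOrderedRing : IsExpOrderedRing (mkRaw ℝ _≈_ _≤_ _+_ _*_ -_ fromℚ exp)
ℝ-isExpOrderedRing = record
  { isCommutativeRing = isCommutativeRing
  ; ι-+         = λ p q → ≈-refl (fromℚ (p ℚ.+ q))
  ; ι-*         = λ p q → ≈-refl (fromℚ (p ℚ.* q))
  ; ι-neg       = λ p → ≈-refl (fromℚ (ℚ.- p))
  ; ι-mono      = λ {p} {q} → fromℚ-mono p q
  ; ≤-reflexive = λ {x} {y} → ≤-reflexive x y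
  ; ≤-trans     = λ {x} {y} {z} → ≤-trans x y z
  ; +-monoˡ-≤   = λ z {x} {y} → +-monoˡ-≤ z x y
  ; *-nonneg    = λ {x} {y} → *-nonnegative x y
  ; 1≰0         = 1≰0
  ; ≤-stable    = λ {x} {y} → ≤-stable x y
  ; ≤-total     = ≤-total
  ; inverse     = λ {x} 1≤x → let x#0 = inj₂ (1≤⇒0< x 1≤x) in inv x x#0 , *-inverse x x#0
  ; exp-cong    = λ {x} {y} → exp-cong x y
  ; exp-+       = exp-+
  ; exp-0       = exp-0
  ; 1+x≤exp     = λ {x} → 1+x≤exp x
  }

module E = ExpOrderedRingProperties (mkRaw ℝ _≈_ _≤_ _+_ _*_ -_ fromℚ exp) ℝ-isExpOrderedRing

module _ (k : ℕ) {p q : ℝ} (1≤p : 1ℝ ≤ p) (0≤q : 0ℝ ≤ q) where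

  twoTerm : PartitionFunction (suc k)
  twoTerm .coeff zero           = p
  twoTerm .coeff (suc i)        = E.spike k q i
  twoTerm .coeff-nonneg zero    = ≤-trans 0ℝ 1ℝ p (fromℚ-mono 0ℚ 1ℚ (ℚ.nonNegative⁻¹ 1ℚ)) 1≤p
  twoTerm .coeff-nonneg (suc i) = E.spike-nonneg k {q} 0≤q i
  twoTerm .1≤coeff₀             = 1≤p

  eval-twoTerm : ∀ b → eval twoTerm [ b ] ≈ p + q * exp (- (nat (suc k) * b))
  eval-twoTerm b = E.sum-two-terms k {p} {q} {b} (λ i → coeff twoTerm i * exp (- (nat (toℕ i) * b)))
    (≈-refl (p * exp (- (nat 0 * b))))
    λ i → ≈-refl (E.spike k q i * exp (- (nat (suc (toℕ i)) * b)))

  ≤eval-twoTerm : ∀ x → p ≤ eval twoTerm x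
  ≤eval-twoTerm [ b ] = ≤-trans p (p + q * exp (- (nat (suc k) * b))) (eval twoTerm [ b ])
    (E.≤two-terms k {p} {q} {b} 0≤q)
    (≤-reflexive (p + q * exp (- (nat (suc k) * b))) (eval twoTerm [ b ])
      (≈-sym (eval twoTerm [ b ]) (p + q * exp (- (nat (suc k) * b))) (eval-twoTerm b)))
  ≤eval-twoTerm ⊤⁺    = ≤-reflexive p p (≈-refl p)

  eval-twoTerm-zero : ∀ b → b ≈ 0ℝ → eval twoTerm [ b ] ≈ p + q
  eval-twoTerm-zero b b≈0 = ≈-trans (eval twoTerm [ b ]) (p + q * exp (- (nat (suc k) * b))) (p + q)
    (eval-twoTerm b) (E.two-terms-at-0 k {p} {q} {b} b≈0)

  eval-twoTerm≤ : ∀ b → q * exp (- (nat (suc k) * b)) ≤ p → eval twoTerm [ b ] ≤ p + p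
  eval-twoTerm≤ b qe≤p = ≤-trans (eval twoTerm [ b ]) (p + q * exp (- (nat (suc k) * b))) (p + p)
    (≤-reflexive (eval twoTerm [ b ]) (p + q * exp (- (nat (suc k) * b))) (eval-twoTerm b))
    (E.two-terms≤ k {p} {q} {b} qe≤p)

  eval²#0 : ∀ x → eval twoTerm x * eval twoTerm x # 0ℝ
  eval²#0 x = inj₂ (1≤⇒0< (eval twoTerm x * eval twoTerm x)
    (E.1≤square {eval twoTerm x} (≤-trans 1ℝ p (eval twoTerm x) 1≤p (≤eval-twoTerm x))))

-- The condition is detached from the schedule to a loose pair of points, so that a finite and an
-- infinite successor can be told apart by matching on `y`.
ChebyshevStep : ℕ → ℝ → ℝ → (x y : ℝ∞) → Set
ChebyshevStep n A B x y = ∀ m → m ℕ.≤ n → (Z : PartitionFunction m) → eval Z [ 0ℝ ] ≈ A →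
  (Z≠0 : eval Z y * eval Z y # 0ℝ) →
  (eval Z (extrapolate x y) * eval Z x) / (eval Z y * eval Z y) ⟨ Z≠0 ⟩ ≤ B

module _ {n : ℕ} {A B L c : ℝ} (exp-L : exp L ≈ A - 1ℝ) (exp-c : exp c ≈ nat 4 * B) where

  not-chebyshev-step : ∀ k b → k ℕ.< n → (S : E.SteepWeights {B} {c} exp-c A (nat (suc k)) b) →
    let open E.SteepWeights S in
    ∀ y → ChebyshevStep n A B [ b ] y → ¬ (eval (twoTerm k {p} {q} 1≤p 0≤q) y ≤ p + p)
  not-chebyshev-step k b k<n S y step w≤2p =
    not-chebyshev {eval Z (extrapolate [ b ] y)} {eval Z [ b ]} {eval Z y} {inv (eval Z y * eval Z y) Z≠0}
      (eval-twoTerm k {p} {q} 1≤p 0≤q b)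
      (≤eval-twoTerm k {p} {q} 1≤p 0≤q (extrapolate [ b ] y))
      (≤eval-twoTerm k {p} {q} 1≤p 0≤q y)
      w≤2p
      (*-inverse (eval Z y * eval Z y) Z≠0)
      (step (suc k) k<n Z (≈-trans (eval Z [ 0ℝ ]) (p + q) A (eval-twoTerm-zero k {p} {q} 1≤p 0≤q 0ℝ (≈-refl 0ℝ)) p+q≈A) Z≠0)
    where
    open E.SteepWeights S
    Z = twoTerm k {p} {q} 1≤p 0≤q
    Z≠0 = eval²#0 k {p} {q} 1≤p 0≤q y

  short-step : ∀ k → k ℕ.< n → ∀ x y → ChebyshevStep n A B x y → E.ShortStep (L - c) c (nat (suc k)) x y
  short-step k k<n [ b ] y step b refl κb≤L-c = go y step
    where
    κ : ℝ
    κ = nat (suc k)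
    S : E.SteepWeights {B} {c} exp-c A κ b
    S = E.steepWeights {B} {c} exp-c {A} {L} exp-L κ b (E.≤-⇒+≤ {κ * b} {c} {L} κb≤L-c)
    open E.SteepWeights S
    go : ∀ y → ChebyshevStep n A B [ b ] y → ∃[ b′ ] y ≡ [ b′ ] × κ * b′ ≤ κ * b + c
    go [ b′ ] step = b′ , refl , ≤-stable (κ * b′) (κ * b + c) λ k≰ → ≤-total (κ * b + c) (κ * b′) λ where
      (inj₁ long)  → not-chebyshev-step k b k<n S [ b′ ] step (eval-twoTerm≤ k {p} {q} 1≤p 0≤q b′ (after b′ long))
      (inj₂ short) → k≰ short
    -- At infinity the test function equals p, which is again at most 2p, so a jump to infinity
    -- violates the same inequality.
    go ⊤⁺ step = contradiction (E.≤+ˡ {p} {p} 0≤p) (not-chebyshev-step k b k<n S ⊤⁺ step)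

  0≤c : 1ℝ ≤ A → ∀ x y → ChebyshevStep n A B x y → 0 ℕ.< n → 0ℝ ≤ c
  0≤c 1≤A x y step 0<n = E.0≤ln[4B] {B} {c} exp-c {A}
    {eval Z (extrapolate x y)} {eval Z x} {eval Z y} {inv (eval Z y * eval Z y) Z≠0} 1≤A
    (eval≈A (extrapolate x y)) (eval≈A x) (eval≈A y) (*-inverse (eval Z y * eval Z y) Z≠0)
    (step 1 0<n Z (eval≈A [ 0ℝ ]) Z≠0)
    where
    0≤0 = ≤-reflexive 0ℝ 0ℝ (≈-refl 0ℝ)
    -- The constant function A, written in degree 1 with q = 0; this degree is admissible because 0
    -- < n.
    Z = twoTerm 0 {A} {0ℝ} 1≤A 0≤0
    Z≠0 = eval²#0 0 {A} {0ℝ} 1≤A 0≤0 y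
    eval≈A : ∀ x → eval Z x ≈ A
    eval≈A [ b ] = ≈-trans (eval Z [ b ]) (A + 0ℝ * exp (- (nat 1 * b))) A
      (eval-twoTerm 0 {A} {0ℝ} 1≤A 0≤0 b) (E.+0* {A} {exp (- (nat 1 * b))})
    eval≈A ⊤⁺ = ≈-refl A

finite : ∀ {x y} → x ≈⁺ [ y ] → ∃[ b ] x ≡ [ b ] × b ≈ y
finite {[ b ]} SupremumEquality.[ b≈y ] = b , refl , b≈y

finite⇒≢⊤ : ∀ {x y} → x ≈⁺ [ y ] → ¬ (x ≡ ⊤⁺)
finite⇒≢⊤ SupremumEquality.[ _ ] ()

lemma3p3 : (n : ℕ) → 0 ℕ.< n →
    (A B : ℝ) → 1ℝ < A → 0ℝ < B →
    (ln-n ln-n/e ln-A-1 ln-4B : ℝ) →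
    IsLn (nat n) ln-n →
    IsLn (nat n / e ⟨ e#0 ⟩) ln-n/e →
    IsLn (A - 1ℝ) ln-A-1 →
    IsLn (nat 4 * B) ln-4B →
    (ln-4B≠0 : ln-4B # 0ℝ) →
    1ℝ ≤ ln-n →
    (ℓ : ℕ) (β : Fin (suc ℓ) → ℝ∞) → IsNonAdaptive n A B β →
    ln-n/e * (ln-A-1 / ln-4B ⟨ ln-4B≠0 ⟩ - 1ℝ) ≤ nat ℓ
lemma3p3 n 0<n A B 1<A 0<B ln-n ln-n/e ln-A-1 ln-4B
  exp-ln-n exp-ln-n/e exp-ln-A-1 exp-ln-4B ln-4B≠0 1≤ln-n zero β (schedule , chebyshev) =
  contradiction (IsSchedule.end schedule) (finite⇒≢⊤ (IsSchedule.start schedule))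
lemma3p3 n 0<n A B 1<A 0<B ln-n ln-n/e ln-A-1 ln-4B
  exp-ln-n exp-ln-n/e exp-ln-A-1 exp-ln-4B ln-4B≠0 1≤ln-n ℓ@(suc _) β (schedule , chebyshev) =
  E.length-bound {ln-n/e} {fromℚ (harmonic n)} {ln-4B} {inv ln-4B ln-4B≠0} {ln-A-1} {nat ℓ}
    (E.0≤ln[n/e] {n} {ln-n/e} {inv e e#0} (*-inverse e e#0) exp-ln-n/e {ln-n} exp-ln-n 1≤ln-n)
    (E.ln[n/e]≤harmonic {n} {ln-n/e} {inv e e#0} (*-inverse e e#0) exp-ln-n/e)
    0≤ln-4B
    (*-inverse ln-4B ln-4B≠0)
    (E.nat-nonneg ℓ)
    -- The schedule starts at 0 only up to `_≈_`, so the count carries a term n b, removed here.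
    (E.drop-≈0 {M * fromℚ (harmonic n)} {nat n} {ln-4B * nat ℓ} {b}
      (E.steps≥harmonic {M} {ln-4B} 0≤ln-4B n ℓ β (IsSchedule.end schedule)
        (λ i k k<n → short-step {n} {A} {B} {ln-A-1} {ln-4B} exp-ln-A-1 exp-ln-4B k k<n (β (inject₁ i)) (β (suc i)) (step i))
        b β₀≡b n ℕ.≤-refl)
      b≈0)
  where
  b : ℝ
  b = proj₁ (finite (IsSchedule.start schedule))
  β₀≡b : β zero ≡ [ b ]
  β₀≡b = proj₁ (proj₂ (finite (IsSchedule.start schedule)))
  b≈0 : b ≈ 0ℝ
  b≈0 = proj₂ (proj₂ (finite (IsSchedule.start schedule)))
  M : ℝ
  M = ln-A-1 - ln-4B
  step : ∀ i → ChebyshevStep n A B (β (inject₁ i)) (β (suc i))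
  step i m m≤n Z Z₀≈A Z≠0 = proj₂ (chebyshev m m≤n Z Z₀≈A (1≤coeff₀ Z)) i Z≠0
  0≤ln-4B : 0ℝ ≤ ln-4B
  0≤ln-4B = 0≤c {n} {A} {B} {ln-A-1} {ln-4B} exp-ln-A-1 exp-ln-4B (<⇒≤ 1ℝ A 1<A)
    (β (inject₁ zero)) (β (suc zero)) (step zero) 0<n
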